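{- Let $G$ be a connected $(P_7,C_7,C_4,\text{gem})$-free graph. Then at least one of the following holds: $G$ has a clique-cutset; $G$ has a bisimplicial vertex; $G$ is a blowup of the Petersen graph.
   Context: All graphs are finite and simple. $P_\ell$ and $C_\ell$ denote the chordless path and chordless cycle on $\ell$ vertices. The gem is the graph consisting of a $P_4$ together with a vertex adjacent to all four vertices of the $P_4$. A graph is $(L_1,L_2,\ldots)$-free if it has no induced subgraph isomorphic to any $L_i$. A clique-cutset of $G$ is a clique $K$ in $G$ such that $G\setminus K$ has more connected components than $G$. A vertex is bisimplicial if its neighborhood is the union of two cliques (not necessarily disjoint, possibly empty). A blowup of a graph $H$ with vertices $v_1,\dots,v_n$ is any graph whose vertex set can be partitioned into $n$ (not necessarily non-empty) cliques $A_1,\dots,A_n$ such that every vertex of $A_i$ is adjacent to every vertex of $A_j$ if $v_iv_j\in E(H)$, and there are no edges between $A_i$ and $A_j$ if $i\neq j$ and $v_iv_j\notin E(H)$. -}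

module Defs where

open import Level using (0ℓ)
open import Data.Nat using (ℕ; suc; _<_; _≤?_)
import Data.Nat as ℕ
open import Data.Nat.Properties using (1+n≢n)
open import Data.Fin using (Fin; toℕ; #_)
import Data.Fin as Fin
open import Data.Fin.Properties using (all?)
open import Data.Fin.Subset using (Subset; _∈_; _⊆_; ⊤; ∁; _∪_; Nonempty)
open import Data.List using (List; []; _∷_)
open import Data.List.Relation.Unary.All using (All)
open import Data.Product using (∃; ∃!; _×_; _,_)
open import Data.Product.Properties using (≡-dec)
open import Data.Sum using (_⊎_; inj₁; inj₂)
import Data.List.Membership.DecPropositional as DecMembership
open import Function.Bundles using (_⇔_)
open import Function.Definitions using (Injective)
open import Relation.Binary.Core using (Rel)
open import Relation.Binary.Definitions using (Decidable; Symmetric; Irreflexive)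
open import Relation.Binary.Construct.Closure.ReflexiveTransitive using (Star)
open import Relation.Binary.Construct.Closure.Symmetric using (SymClosure; fwd; bwd; symmetric)
open import Relation.Binary.PropositionalEquality using (_≡_; _≢_; refl; trans; sym; cong)
open import Relation.Nullary using (¬_)
open import Relation.Nullary.Decidable using (True; toWitness; map′; ¬?; _⊎-dec_; _×-dec_)

-- Adjacency is decidable by definition: a finite graph is explicitly given data.
record Graph : Set₁ where
  field
    order      : ℕ
    Adj        : Rel (Fin order) 0ℓ
    adj?       : Decidable Adj
    adj-sym    : Symmetric Adj
    adj-irrefl : Irreflexive _≡_ Adj

  Vertex : Set
  Vertex = Fin order

open Graph

symGraph : ∀ {n} (R : Rel (Fin n) 0ℓ) → Decidable R → (∀ i → ¬ R i i) → Graph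
symGraph {n} R R? irr = record
  { order      = n
  ; Adj        = SymClosure R
  ; adj?       = λ i j → map′ (λ { (inj₁ r) → fwd r ; (inj₂ r) → bwd r })
                              (λ { (fwd r) → inj₁ r ; (bwd r) → inj₂ r })
                              (R? i j ⊎-dec R? j i)
  ; adj-sym    = symmetric R
  ; adj-irrefl = λ { {i} refl (fwd r) → irr i r ; {i} refl (bwd r) → irr i r }
  }

module _ {n : ℕ} where
  open DecMembership (≡-dec (Fin._≟_ {n}) (Fin._≟_ {n}))
    using (_∈?_) renaming (_∈_ to _∈ₗ_)

  edgeGraph : (es : List (Fin n × Fin n)) →
              {True (all? (λ i → ¬? ((i , i) ∈? es)))} → Graph
  edgeGraph es {irr} =
    symGraph (λ i j → (i , j) ∈ₗ es) (λ i j → (i , j) ∈? es) (toWitness irr)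

P : ℕ → Graph
P ℓ = symGraph {ℓ} (λ i j → toℕ j ≡ suc (toℕ i))
                   (λ i j → toℕ j ℕ.≟ suc (toℕ i))
                   (λ i e → 1+n≢n (sym e))

-- The closing edge joins the last vertex to vertex 0; the restriction
-- ℓ ≥ 3 is what makes this a simple cycle.
C : (ℓ : ℕ) → {True (3 ≤? ℓ)} → Graph
C ℓ {3≤ℓ} = symGraph {ℓ}
  (λ i j → toℕ j ≡ suc (toℕ i) ⊎ (suc (toℕ i) ≡ ℓ × toℕ j ≡ 0))
  (λ i j → (toℕ j ℕ.≟ suc (toℕ i)) ⊎-dec ((suc (toℕ i) ℕ.≟ ℓ) ×-dec (toℕ j ℕ.≟ 0)))
  λ { i (inj₁ e)         → 1+n≢n (sym e)
    ; i (inj₂ (last , z)) → absurd (trans (sym last) (cong suc z)) (toWitness 3≤ℓ) }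
  where
  absurd : ∀ {m} → m ≡ 1 → ¬ (3 ℕ.≤ m)
  absurd refl (ℕ.s≤s ())

-- Vertices 0-1-2-3 form the P₄; vertex 4 dominates it.
gem : Graph
gem = edgeGraph {5}
  ( (# 0 , # 1) ∷ (# 1 , # 2) ∷ (# 2 , # 3)
  ∷ (# 4 , # 0) ∷ (# 4 , # 1) ∷ (# 4 , # 2) ∷ (# 4 , # 3) ∷ [])

-- Outer 5-cycle 0-1-2-3-4, inner pentagram 5-7-9-6-8, and five spokes.
petersen : Graph
petersen = edgeGraph {10}
  ( (# 0 , # 1) ∷ (# 1 , # 2) ∷ (# 2 , # 3) ∷ (# 3 , # 4) ∷ (# 4 , # 0)
  ∷ (# 5 , # 7) ∷ (# 7 , # 9) ∷ (# 9 , # 6) ∷ (# 6 , # 8) ∷ (# 8 , # 5)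
  ∷ (# 0 , # 5) ∷ (# 1 , # 6) ∷ (# 2 , # 7) ∷ (# 3 , # 8) ∷ (# 4 , # 9) ∷ [])

-- H is isomorphic to the subgraph of G induced by the image of f.
HasInduced : Graph → Graph → Set
HasInduced G H = ∃ λ (f : Vertex H → Vertex G) →
  Injective _≡_ _≡_ f × (∀ u v → Adj H u v ⇔ Adj G (f u) (f v))

Free : List Graph → Graph → Set₁
Free Ls G = All (λ L → ¬ HasInduced G L) Ls

Connected : Graph → Set
Connected G = ∀ u v → Star (Adj G) u v

module _ (G : Graph) where

  IsClique : Subset (order G) → Set
  IsClique K = ∀ {u v} → u ∈ K → v ∈ K → u ≢ v → Adj G u v

  -- Adjacency in the subgraph G[S].  Outside S, Star (AdjIn S) is still
  -- reflexive, so connectivity in G[S] is only ever read at vertices of S.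
  AdjIn : Subset (order G) → Rel (Vertex G) 0ℓ
  AdjIn S u v = u ∈ S × v ∈ S × Adj G u v

  IsComponent : (S D : Subset (order G)) → Set
  IsComponent S D = Nonempty D × D ⊆ S ×
    (∀ {u} → u ∈ D → ∀ {v} → v ∈ S → v ∈ D ⇔ Star (AdjIn S) u v)

  -- G[S] has exactly k connected components.
  HasComponents : Subset (order G) → ℕ → Set
  HasComponents S k = ∃ λ (D : Fin k → Subset (order G)) →
    Injective _≡_ _≡_ D ×
    (∀ i → IsComponent S (D i)) ×
    (∀ E → IsComponent S E → ∃ λ i → D i ≡ E)

  IsCliqueCutset : Subset (order G) → Set
  IsCliqueCutset K = IsClique K ×
    ∃ λ k → ∃ λ l → HasComponents ⊤ k × HasComponents (∁ K) l × k < l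

  HasCliqueCutset : Set
  HasCliqueCutset = ∃ IsCliqueCutset

  Bisimplicial : Vertex G → Set
  Bisimplicial v = ∃ λ K → ∃ λ L → IsClique K × IsClique L ×
    (∀ u → Adj G v u ⇔ u ∈ K ∪ L)

  -- ∃! puts every vertex in exactly one A i; the A i may be empty.
  IsBlowupOf : Graph → Set
  IsBlowupOf H = ∃ λ (A : Vertex H → Subset (order G)) →
    (∀ v → ∃! _≡_ (λ i → v ∈ A i)) ×
    (∀ i → IsClique (A i)) ×
    (∀ {i j} → Adj H i j → ∀ {u v} → u ∈ A i → v ∈ A j → Adj G u v) ×
    (∀ {i j} → i ≢ j → ¬ Adj H i j → ∀ {u v} → u ∈ A i → v ∈ A j → ¬ Adj G u v)

{-# OPTIONS --safe #-}

-- If G contains a Petersen graph, classify the other vertices by their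
-- neighbours on it: twins of one of its vertices, and strays, whose neighbours
-- on it form a clique.  Replacing vertices by their twins gives new Petersen
-- graphs, so twins are joined as in a blowup, and adjacent strays see the same
-- twins, which form a clique.  Hence G is a blowup or a stray yields a
-- clique-cutset.
--
-- Otherwise take a maximal connected set D such that some vertex r outside D has
-- no neighbour in D.  Maximality makes every such vertex adjacent to every
-- neighbour of D.  If the neighbours of D form a clique, they are a
-- cutset.  If not, C₄-freeness makes D the whole non-neighbourhood of r, and
-- every neighbour of r in an independent pair of N(r) has a neighbour in D.
-- Were no vertex bisimplicial, every independent pair of neighbours of a vertex
-- could be enlarged to three independent neighbours.  Starting from such a claw
-- at r and from shortest walks through D between its leaves, a finite case
-- analysis then always meets P₇, C₇, C₄, the gem or the Petersen graph.
module Submission where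

open import Defs
open import Data.Bool using (Bool; true; false; not; T; _∨_)
import Data.Bool as Bool
open import Data.Empty using (⊥; ⊥-elim)
open import Data.Fin using (Fin; toℕ; #_)
import Data.Fin as Fin
open import Data.Fin.Properties using (any?; all?; <-cmp; <⇒≢; toℕ<n; fromℕ<-toℕ)
open import Data.Fin.Subset
  using (Subset; _∈_; _∉_; _⊆_; _⊃_; _∪_; ∁; ⁅_⁆; Nonempty)
import Data.Fin.Subset as Subset
open import Data.Fin.Subset.Induction using (⊃-wellFounded)
open import Data.Fin.Subset.Properties
  using (_∈?_; ∈⊤; x∈⁅x⁆; x∈⁅y⁆⇒x≡y; x∈p∪q⁺; x∈p∪q⁻; p⊆p∪q; ⊆-antisym; x∈∁p⇒x∉p; x∉p⇒x∈∁p)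
open import Data.List
  using (List; []; _∷_; _++_; length; map; filter; tabulate; allFin; upTo; cartesianProduct; deduplicate)
import Data.List as List
open import Data.List.Membership.Propositional.Properties
  using (∈-lookup; ∈-map⁺; ∈-map⁻; ∈-filter⁺; ∈-filter⁻; ∈-allFin; ∈-upTo⁺; ∈-cartesianProduct⁺;
         ∈-deduplicate⁺; ∈-deduplicate⁻)
open import Data.List.Properties using (map-∘)
open import Data.List.Relation.Unary.All using (All; []; _∷_)
import Data.List.Relation.Unary.All as All
import Data.List.Relation.Unary.All.Properties as Allₚ
open import Data.List.Relation.Unary.AllPairs using (_∷_)
open import Data.List.Relation.Unary.Any using (Any; here; index)
import Data.List.Relation.Unary.Any as Any
open import Data.List.Relation.Unary.Any.Properties using (lookup-index)
open import Data.List.Relation.Unary.Unique.DecPropositional.Properties using (deduplicate-!)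
open import Data.List.Relation.Unary.Unique.Propositional using (Unique)
open import Data.Maybe using (Maybe; just; nothing; _>>=_; _<∣>_; is-just; to-witness-T)
import Data.Maybe as Maybe
open import Data.Nat using (ℕ; zero; suc; _+_; _≡ᵇ_; _≟_; _<_; _≤_; _<?_; s<s; z≤n; s≤s)
open import Data.Nat.Induction using (<-wellFounded)
open import Data.Nat.Properties
  using (anyUpTo?; ≤-refl; <-trans; ≤-<-trans; n<1+n; m≤n⇒m≤1+n)
open import Data.Product using (∃; ∃!; _×_; _,_; proj₁; proj₂)
open import Data.Sum using (_⊎_; inj₁; inj₂)
import Data.Sum as Sum
open import Data.Unit using (⊤; tt)
open import Data.Vec using (Vec; []; _∷_)
import Data.Vec as Vec
import Data.Vec.Properties as Vecₚ
open import Function using (_∘_)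
open import Function.Bundles using (Equivalence; mk⇔)
open import Function.Definitions using (Injective)
open import Induction.WellFounded using (Acc; acc)
open import Relation.Binary.Construct.Closure.ReflexiveTransitive
  using (Star; ε; _◅_; _◅◅_; reverse)
import Relation.Binary.Construct.Closure.ReflexiveTransitive as Star
open import Relation.Binary.Definitions using (tri<; tri≈; tri>)
open import Relation.Binary.PropositionalEquality
  using (_≡_; _≢_; refl; sym; trans; cong; cong₂; subst; subst₂)
open import Relation.Nullary using (¬_; Dec; yes; no; contradiction; does)
open import Relation.Nullary.Decidable
  using (_×-dec_; _⊎-dec_; _→-dec_; ¬?; dec-true; dec-false; from-yes)
open import Relation.Unary using (Decidable)

-- Named configurations and a checker for finite case analyses

-- The analysis at the claw must be finite although the walks through D have unknown length. They
-- are therefore named one vertex at a time: on a shortest walk each new vertex is independent of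
-- all earlier ones but its predecessor, so after a few steps the walk and the claw contain `P 7` or
-- `C 7`. The other source of vertices is the lack of bisimplicial vertices, which enlarges
-- independent pairs at any vertex, not only at r. For a leaf v and a pair containing r, one outcome
-- would be two independent common neighbours of r and v. It is excluded by choosing leaves for
-- which N(r) ∩ N(v) is a clique. Such leaves exist: replacing v by one of two independent common
-- neighbours strictly enlarges its non-neighbourhood in N(r), which also keeps the three leaves
-- independent. The Petersen graph arises from `claw-with-path`, which is the Petersen graph less
-- three vertices; forks supply these or lead to a forbidden subgraph. The searches leave behind
-- only trees, whose branches the checker justifies one by one.

module Basics (G : Graph) where
  open Graph G public

  Sep : Vertex → Vertex → Set
  Sep u v = u ≢ v × ¬ Adj u v

  Sep-sym : ∀ {u v} → Sep u v → Sep v u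
  Sep-sym (u≢v , ¬uv) = u≢v ∘ sym , ¬uv ∘ adj-sym

  Link : Bool → Vertex → Vertex → Set
  Link true  = Adj
  Link false = Sep

  Link-sym : ∀ b {u v} → Link b u v → Link b v u
  Link-sym true  = adj-sym
  Link-sym false = Sep-sym

  Link⇒≢ : ∀ b {u v} → Link b u v → u ≢ v
  Link⇒≢ true  uv u≡v = adj-irrefl u≡v uv
  Link⇒≢ false        = proj₁

  Link-unique : ∀ {b c u v} → Link b u v → Link c u v → b ≡ c
  Link-unique {true}  {true}  _ _ = refl
  Link-unique {true}  {false} p q = contradiction p (proj₂ q)
  Link-unique {false} {true}  p q = contradiction q (proj₂ p)
  Link-unique {false} {false} _ _ = refl

  data Compare (u v : Vertex) : Set where
    same : u ≡ v → Compare u v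
    near : Adj u v → Compare u v
    far  : Sep u v → Compare u v

  compare : ∀ u v → Compare u v
  compare u v with u Fin.≟ v | adj? u v
  ... | yes u≡v | _      = same u≡v
  ... | no  _   | yes uv = near uv
  ... | no  u≢v | no ¬uv = far (u≢v , ¬uv)

  Induces : (H : Graph) → (Graph.Vertex H → Vertex) → Set
  Induces H f = ∀ i j → i ≢ j → Link (does (Graph.adj? H i j)) (f i) (f j)

  Induces⇒HasInduced : ∀ {H f} → Induces H f → HasInduced G H
  Induces⇒HasInduced {H} {f} ind = f , injective , λ i j → mk⇔ (to i j) (from i j)
    where
    module H = Graph H
    injective : ∀ {i j} → f i ≡ f j → i ≡ j
    injective {i} {j} fi≡fj with i Fin.≟ j
    ... | yes i≡j = i≡j
    ... | no  i≢j = contradiction fi≡fj (Link⇒≢ (does (H.adj? i j)) (ind i j i≢j))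
    to : ∀ i j → H.Adj i j → Adj (f i) (f j)
    to i j ij with H.adj? i j | ind i j (λ i≡j → H.adj-irrefl i≡j ij)
    ... | yes _   | l = l
    ... | no  ¬ij | _ = contradiction ij ¬ij
    from : ∀ i j → Adj (f i) (f j) → H.Adj i j
    from i j fij with H.adj? i j | ind i j (λ { refl → adj-irrefl refl fij })
    ... | yes ij | _ = ij
    ... | no  _  | l = contradiction fij (proj₂ l)

  HasInduced⇒Induces : ∀ {H} → (h : HasInduced G H) → Induces H (proj₁ h)
  HasInduced⇒Induces {H} (f , injective , iff) i j i≢j with Graph.adj? H i j
  ... | yes ij = Equivalence.to (iff i j) ij
  ... | no ¬ij = i≢j ∘ injective , ¬ij ∘ Equivalence.from (iff i j)

-- Numbers are names, interpreted by an environment. What `tag` and `walk` assert is left to the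
-- parameters of `Engine`, so one checker serves both the claw and the surroundings of a Petersen
-- graph.
data Fact : Set where
  link : Bool → ℕ → ℕ → Fact
  neq  : ℕ → ℕ → Fact
  tag  : ℕ → ℕ → Fact
  walk : ℕ → List ℕ → List ℕ → Fact

Facts : Set
Facts = List Fact

links : Graph → Facts
links H = map (λ (i , j) → link (does (Graph.adj? H i j)) (toℕ i) (toℕ j))
              (filter (λ (i , j) → i Fin.<? j) (cartesianProduct vertices vertices))
  where
  vertices = allFin (Graph.order H)

-- cite k σ closes a branch by the k-th known configuration renamed along σ.
-- split i j k branches on the adjacency of i and j, which are distinct because
-- exactly one of them is known to be adjacent to k (k is irrelevant if neq i j
-- is known).  fork f a b n enlarges the independent pair a, b of neighbours of
-- f, either by n or by replacing a or b with the independent pair n, n + 1.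
-- begin and step trace a shortest walk from a vertex to a neighbour of a set.
data Tree : Set where
  cite  : ℕ → List ℕ → Tree
  split : ℕ → ℕ → ℕ → Tree → Tree → Tree
  fork  : ℕ → ℕ → ℕ → ℕ → Tree → Tree → Tree → Tree
  begin : ℕ → ℕ → List ℕ → Tree → Tree
  step  : ℕ → Tree → Tree

Env : Graph → Set
Env G = ℕ → Graph.Vertex G

_[_≔_] : ∀ {A : Set} → (ℕ → A) → ℕ → A → ℕ → A
(ρ [ n ≔ v ]) m with m ≡ᵇ n
... | true  = v
... | false = ρ m

module Engine
  (G : Graph) (Q : Set)
  (Tag  : ℕ → Graph.Vertex G → Set)
  (Walk : Graph.Vertex G → List (Graph.Vertex G) → List (Graph.Vertex G) → Set)
  where
  open Basics G

  Holds : Env G → Fact → Set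
  Holds ρ (link b i j)  = Link b (ρ i) (ρ j)
  Holds ρ (neq i j)     = ρ i ≢ ρ j
  Holds ρ (tag k i)     = Tag k (ρ i)
  -- Conditional, since later splits decide whether i is already adjacent to L.
  Holds ρ (walk i is L) =
    All (Sep (ρ i)) (map ρ L) → Walk (ρ i) (map ρ is) (map ρ L)

  -- The conclusion is Q rather than ⊥ because a configuration may also be closed
  -- by proving the goal from it.
  Settles : Facts → Set
  Settles Γ = ∀ ρ → All (Holds ρ) Γ → Q

  settles-links : ∀ {H} → (HasInduced G H → Q) → Settles (links H)
  settles-links {H} q ρ all = q (Induces⇒HasInduced {H} {ρ ∘ toℕ} ind)
    where
    below : ∀ i j → i Fin.< j → Link (does (Graph.adj? H i j)) (ρ (toℕ i)) (ρ (toℕ j))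
    below i j i<j = All.lookup (Allₚ.map⁻ all)
      (∈-filter⁺ (λ (i , j) → i Fin.<? j) (∈-cartesianProduct⁺ (∈-allFin i) (∈-allFin j)) i<j)
    adj-comm : ∀ i j → does (Graph.adj? H i j) ≡ does (Graph.adj? H j i)
    adj-comm i j with Graph.adj? H i j | Graph.adj? H j i
    ... | yes _  | yes _  = refl
    ... | no  _  | no  _  = refl
    ... | yes ij | no ¬ji = contradiction (Graph.adj-sym H ij) ¬ji
    ... | no ¬ij | yes ji = contradiction (Graph.adj-sym H ji) ¬ij
    ind : Induces H (ρ ∘ toℕ)
    ind i j i≢j with <-cmp i j
    ... | tri< i<j _ _ = below i j i<j
    ... | tri≈ _ i≡j _ = contradiction i≡j i≢j
    ... | tri> _ _ j<i = subst (λ b → Link b (ρ (toℕ i)) (ρ (toℕ j))) (adj-comm j i)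
                              (Link-sym (does (Graph.adj? H j i)) (below j i j<i))

  _⊩_ : Facts → Fact → Set
  Γ ⊩ φ = ∀ ρ → All (Holds ρ) Γ → Holds ρ φ

  match : ∀ φ ψ → Maybe (∀ ρ → Holds ρ φ → Holds ρ ψ)
  match (link b i j) (link c k l) with b Bool.≟ c
  ... | no  _    = nothing
  ... | yes refl with i ≟ k | j ≟ l | i ≟ l | j ≟ k
  ... | yes refl | yes refl | _        | _        = just λ _ h → h
  ... | yes _    | no  _    | yes refl | yes refl = just λ _ → Link-sym b
  ... | no  _    | _        | yes refl | yes refl = just λ _ → Link-sym b
  ... | _        | _        | _        | _        = nothing
  match (neq i j) (neq k l) with i ≟ k | j ≟ l
  ... | yes refl | yes refl = just λ _ h → h
  ... | _        | _        = nothing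
  match (tag m i) (tag n j) with m ≟ n | i ≟ j
  ... | yes refl | yes refl = just λ _ h → h
  ... | _        | _        = nothing
  match _ _ = nothing

  find : ∀ Γ φ → Maybe (Γ ⊩ φ)
  find []      φ = nothing
  find (ψ ∷ Γ) φ with match ψ φ
  ... | just ψ⇒φ = just λ { ρ (h ∷ _) → ψ⇒φ ρ h }
  ... | nothing  = Maybe.map (λ Γ⊩φ → λ { ρ (_ ∷ hs) → Γ⊩φ ρ hs }) (find Γ φ)

  findAll : ∀ Γ Δ → Maybe (∀ ρ → All (Holds ρ) Γ → All (Holds ρ) Δ)
  findAll Γ []      = just λ _ _ → []
  findAll Γ (φ ∷ Δ) = do
    p ← find Γ φ
    q ← findAll Γ Δ
    just λ ρ hs → p ρ hs ∷ q ρ hs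

  findWalk : ∀ Γ → Maybe (∃ λ i → ∃ λ is → ∃ λ L → Γ ⊩ walk i is L)
  findWalk []                = nothing
  findWalk (walk i is L ∷ Γ) = just (i , is , L , λ { ρ (h ∷ _) → h })
  findWalk (_ ∷ Γ)           =
    Maybe.map (λ (i , is , L , p) → i , is , L , λ { ρ (_ ∷ hs) → p ρ hs }) (findWalk Γ)

  distinct : ∀ Γ i j k → Maybe (∀ ρ → All (Holds ρ) Γ → ρ i ≢ ρ j)
  distinct Γ i j k = find Γ (neq i j) <∣> via true <∣> via false
    where
    via : Bool → Maybe (∀ ρ → All (Holds ρ) Γ → ρ i ≢ ρ j)
    via b = do
      p ← find Γ (link b i k)
      q ← find Γ (link (not b) j k)
      just λ ρ hs i≡j → clash b
        (Link-unique (subst (λ v → Link b v (ρ k)) i≡j (p ρ hs)) (q ρ hs))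
      where
      clash : ∀ b → b ≢ not b
      clash true ()
      clash false ()

  rename : (ℕ → ℕ) → Fact → Fact
  rename σ (link b i j)  = link b (σ i) (σ j)
  rename σ (neq i j)     = neq (σ i) (σ j)
  rename σ (tag k i)     = tag k (σ i)
  rename σ (walk i is L) = walk (σ i) (map σ is) (map σ L)

  Holds-rename : ∀ ρ σ φ → Holds ρ (rename σ φ) → Holds (ρ ∘ σ) φ
  Holds-rename ρ σ (link b i j)  h = h
  Holds-rename ρ σ (neq i j)     h = h
  Holds-rename ρ σ (tag k i)     h = h
  Holds-rename ρ σ (walk i is L) h
    rewrite map-∘ {g = ρ} {f = σ} is | map-∘ {g = ρ} {f = σ} L = h

  new : ∀ (ρ : Env G) n v → (ρ [ n ≔ v ]) n ≡ v
  new ρ n v with n ≡ᵇ n | ≡ᵇ-refl n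
    where
    ≡ᵇ-refl : ∀ n → (n ≡ᵇ n) ≡ true
    ≡ᵇ-refl zero    = refl
    ≡ᵇ-refl (suc n) = ≡ᵇ-refl n
  ... | true | _ = refl

  old : ∀ n m → Maybe (∀ (ρ : Env G) v → ρ m ≡ (ρ [ n ≔ v ]) m)
  old n m with m ≡ᵇ n
  ... | true  = nothing
  ... | false = just λ _ _ → refl

  olds : ∀ n ms → Maybe (∀ (ρ : Env G) v → map ρ ms ≡ map (ρ [ n ≔ v ]) ms)
  olds n []       = just λ _ _ → refl
  olds n (m ∷ ms) = do
    p ← old n m
    q ← olds n ms
    just λ ρ v → cong₂ _∷_ (p ρ v) (q ρ v)

  -- Walk facts do not survive the introduction of an unrelated vertex.
  survives : ∀ n φ → Maybe (∀ ρ v → Holds ρ φ → Holds (ρ [ n ≔ v ]) φ)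
  survives n (link b i j) = do
    p ← old n i
    q ← old n j
    just λ ρ v → subst₂ (Link b) (p ρ v) (q ρ v)
  survives n (neq i j) = do
    p ← old n i
    q ← old n j
    just λ ρ v → subst₂ _≢_ (p ρ v) (q ρ v)
  survives n (tag k i) = do
    p ← old n i
    just λ ρ v → subst (Tag k) (p ρ v)
  survives n (walk _ _ _) = nothing

  -- This makes reassigning a name sound: whatever was known about its former bearer is dropped.
  survivors : ∀ n Γ → ∃ λ Δ → ∀ ρ v → All (Holds ρ) Γ → All (Holds (ρ [ n ≔ v ])) Δ
  survivors n []      = [] , λ _ _ _ → []
  survivors n (φ ∷ Γ) with survives n φ | survivors n Γ
  ... | nothing | Δ , p = Δ , λ { ρ v (_ ∷ hs) → p ρ v hs }
  ... | just s  | Δ , p = φ ∷ Δ , λ { ρ v (h ∷ hs) → s ρ v h ∷ p ρ v hs }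

  Row : Env G → List (Bool × ℕ) → Vertex → Set
  Row ρ c v = All (λ (b , m) → Link b (ρ m) v) c

  row : ℕ → List (Bool × ℕ) → Facts
  row n = map λ (b , m) → link b m n

  keepRow : ∀ n c → Maybe (∀ ρ v w → Row ρ c w → Row (ρ [ n ≔ v ]) c w)
  keepRow n []            = just λ _ _ _ _ → []
  keepRow n ((b , m) ∷ c) = do
    p ← old n m
    q ← keepRow n c
    just λ { ρ v w (l ∷ ls) → subst (λ u → Link b u w) (p ρ v) l ∷ q ρ v w ls }

  Extends : ℕ → Facts → List (Bool × ℕ) → Facts → Set
  Extends n Γ c Δ = ∀ ρ v → All (Holds ρ) Γ → Row ρ c v → All (Holds (ρ [ n ≔ v ])) Δ

  extend : ∀ n Γ c → Maybe (∃ (Extends n Γ c))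
  extend n Γ c = Maybe.map (λ p → row n c ++ proj₁ (survivors n Γ) , extends p) (keepRow n c)
    where
    extends : (∀ ρ v w → Row ρ c w → Row (ρ [ n ≔ v ]) c w) →
              Extends n Γ c (row n c ++ proj₁ (survivors n Γ))
    extends p ρ v hs ls = Allₚ.++⁺
      (Allₚ.map⁺ (All.map (λ {(b , m)} → subst (Link b _) (sym (new ρ n v))) (p ρ v v ls)))
      (proj₂ (survivors n Γ) ρ v hs)

  record Rules : Set₁ where
    field
      fork-rule : ∀ {f a b} → Adj f a → Adj f b → Sep a b →
        (∀ x → Adj f x → Sep a x → Sep b x → Q) →
        (∀ x y → Adj f x → Adj a x → Sep b x → Adj f y → Adj a y → Sep b y → Sep x y → Q) →
        (∀ x y → Adj f x → Adj b x → Sep a x → Adj f y → Adj b y → Sep a y → Sep x y → Q) →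
        Q
      Joined      : Vertex → Set
      far-joined  : ∀ {r x} → Tag 0 r → Sep r x → Joined x
      leaf-joined : ∀ {x} → Tag 1 x → Joined x
      begin-rule  : ∀ {x l L} → Joined x → Joined l →
        All (Sep x) (l ∷ L) → Walk x [] (l ∷ L)
      step-rule   : ∀ {r x xs L} → Tag 0 r → Walk x xs L →
        (∀ y → Adj x y → Sep r y → All (λ z → Sep z y) xs →
               (All (Sep y) L → Walk y (x ∷ xs) L) → Q) →
        Q

  Known : Set
  Known = List (∃ Settles)

  at : Known → ℕ → Maybe (∃ Settles)
  at []       _       = nothing
  at (s ∷ ss) zero    = just s
  at (s ∷ ss) (suc k) = at ss k

  name : List ℕ → ℕ → ℕ
  name []       _       = 0
  name (m ∷ ms) zero    = m
  name (m ∷ ms) (suc k) = name ms k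

  module Check (known : Known) (rules : Maybe Rules) where

    joined : (R : Rules) → ∀ Γ i → Maybe (∀ ρ → All (Holds ρ) Γ → Rules.Joined R (ρ i))
    joined R Γ i = leaf <∣> other
      where
      open Rules R
      leaf  = Maybe.map (λ p ρ hs → leaf-joined (p ρ hs)) (find Γ (tag 1 i))
      other = do
        p ← find Γ (tag 0 0)
        q ← find Γ (link false 0 i)
        just λ ρ hs → far-joined (p ρ hs) (q ρ hs)

    check : Tree → ∀ Γ → Maybe (Settles Γ)
    check (cite k ms) Γ = do
      Δ , settled ← at known k
      p ← findAll Γ (map (rename (name ms)) Δ)
      just λ ρ hs → settled (ρ ∘ name ms)
        (All.map (λ {φ} → Holds-rename ρ (name ms) φ) (Allₚ.map⁻ (p ρ hs)))
    check (split i j k t u) Γ = do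
      d ← distinct Γ i j k
      p ← check t (link true i j ∷ Γ)
      q ← check u (link false i j ∷ Γ)
      just λ ρ hs → case-split ρ hs (d ρ hs) (λ l → p ρ (l ∷ hs)) (λ l → q ρ (l ∷ hs))
      where
      case-split : ∀ ρ → All (Holds ρ) Γ → ρ i ≢ ρ j →
                   (Adj (ρ i) (ρ j) → Q) → (Sep (ρ i) (ρ j) → Q) → Q
      case-split ρ hs i≢j p q with adj? (ρ i) (ρ j)
      ... | yes ij = p ij
      ... | no ¬ij = q (i≢j , ¬ij)
    check (fork f a b n t u v) Γ = do
      R ← rules
      fa ← find Γ (link true f a)
      fb ← find Γ (link true f b)
      ab ← find Γ (link false a b)
      Γ₁ , ext₁ ← extend n Γ ((true , f) ∷ (false , a) ∷ (false , b) ∷ [])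
      p  ← check t Γ₁
      q  ← pair a b u
      r  ← pair b a v
      just λ ρ hs → Rules.fork-rule R (fa ρ hs) (fb ρ hs) (ab ρ hs)
        (λ x fx ax bx → p _ (ext₁ ρ x hs (fx ∷ ax ∷ bx ∷ [])))
        (q ρ hs)
        (r ρ hs)
      where
      pair : ∀ a b → Tree → Maybe (∀ ρ → All (Holds ρ) Γ →
        ∀ x y → Adj (ρ f) x → Adj (ρ a) x → Sep (ρ b) x →
                Adj (ρ f) y → Adj (ρ a) y → Sep (ρ b) y → Sep x y → Q)
      pair a b t = do
        let c = (true , f) ∷ (true , a) ∷ (false , b) ∷ []
        Γ₁ , ext₁ ← extend n Γ c
        kept      ← keepRow n c
        Γ₂ , ext₂ ← extend (suc n) Γ₁ ((false , n) ∷ c)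
        p         ← check t Γ₂
        just λ ρ hs x y fx ax bx fy ay by xy → p _ (ext₂ _ y
          (ext₁ ρ x hs (fx ∷ ax ∷ bx ∷ []))
          (subst (λ u → Sep u y) (sym (new ρ n x)) xy ∷ kept ρ x y (fy ∷ ay ∷ by ∷ [])))
    check (begin i l L t) Γ = do
      R ← rules
      jᵢ ← joined R Γ i
      jₗ ← joined R Γ l
      p ← check t (walk i [] (l ∷ L) ∷ Γ)
      just λ ρ hs → p ρ (Rules.begin-rule R (jᵢ ρ hs) (jₗ ρ hs) ∷ hs)
    check (step n t) Γ = do
      R ← rules
      apex ← find Γ (tag 0 0)
      i , is , L , w ← findWalk Γ
      away ← findAll Γ (map (link false i) L)
      -- The new vertex is adjacent to the end of the walk, away from the apex (name 0), and
      -- independent of the earlier vertices because the walk is shortest.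
      let c = (true , i) ∷ (false , 0) ∷ map (false ,_) is
      Γ₁ , ext ← extend n Γ c
      eᵢ  ← old n i
      eᵢₛ ← olds n is
      eₗ  ← olds n L
      p ← check t (walk n (i ∷ is) L ∷ Γ₁)
      just λ ρ hs → Rules.step-rule R (apex ρ hs)
        (w ρ hs (Allₚ.map⁺ (Allₚ.map⁻ (away ρ hs))))
        λ y iy ry sep next → p (ρ [ n ≔ y ])
          (transport (sym (new ρ n y)) (eᵢ ρ y) (eᵢₛ ρ y) (eₗ ρ y) next
            ∷ ext ρ y hs (iy ∷ ry ∷ Allₚ.map⁺ (Allₚ.map⁻ sep)))
      where
      transport : ∀ {y y′ u u′ us us′ M M′} → y ≡ y′ → u ≡ u′ → us ≡ us′ → M ≡ M′ →
        (All (Sep y) M → Walk y (u ∷ us) M) → All (Sep y′) M′ → Walk y′ (u′ ∷ us′) M′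
      transport refl refl refl refl next = next

    settle : ∀ t Γ → {T (is-just (check t Γ))} → Settles Γ
    settle t Γ {ok} = to-witness-T (check t Γ) ok

module Forbidden (G : Graph) (¬C4 : ¬ HasInduced G (C 4)) (¬gem : ¬ HasInduced G gem) where
  open Basics G
  open Engine G ⊥ (λ _ _ → ⊥) (λ _ _ _ → ⊥)

  no-C4 : ∀ {a b c d} → Adj a b → Adj b c → Adj c d → Adj d a → Sep a c → ¬ Sep b d
  -- `links` lists the pairs lexicographically: 01, 02, 03, 12, 13, 23.
  no-C4 {a} {b} {c} {d} ab bc cd da ac bd = settles-links {C 4} ¬C4
    (λ { 0 → a ; 1 → b ; 2 → c ; _ → d }) (ab ∷ ac ∷ adj-sym da ∷ bc ∷ bd ∷ cd ∷ [])

  no-gem : ∀ {a b c d v} → Adj a b → Adj b c → Adj c d → Sep a c → Sep b d → Sep a d →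
    Adj v a → Adj v b → Adj v c → ¬ Adj v d
  no-gem {a} {b} {c} {d} {v} ab bc cd ac bd ad va vb vc vd = settles-links {gem} ¬gem
    (λ { 0 → a ; 1 → b ; 2 → c ; 3 → d ; _ → v })
    (ab ∷ ac ∷ ad ∷ adj-sym va ∷ bc ∷ bd ∷ adj-sym vb ∷ cd ∷ adj-sym vc ∷ adj-sym vd ∷ [])

-- Components and clique-cutsets

⟦_⟧ : ∀ {n} {P : Fin n → Set} → Decidable P → Subset n
⟦ P? ⟧ = Vec.tabulate (λ i → does (P? i))

module _ {n} {P : Fin n → Set} (P? : Decidable P) where

  ∈⟦⟧⁺ : ∀ {i} → P i → i ∈ ⟦ P? ⟧
  ∈⟦⟧⁺ {i} p = Vecₚ.lookup⇒[]= i ⟦ P? ⟧ (trans (Vecₚ.lookup∘tabulate _ i) (dec-true (P? i) p))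

  ∈⟦⟧⁻ : ∀ {i} → i ∈ ⟦ P? ⟧ → P i
  ∈⟦⟧⁻ {i} i∈ with P? i | trans (sym (Vecₚ.lookup∘tabulate (λ i → does (P? i)) i)) (Vecₚ.[]=⇒lookup i∈)
  ... | yes p | _ = p

lookup-injective : ∀ {A : Set} {xs : List A} → Unique xs → Injective _≡_ _≡_ (List.lookup xs)
lookup-injective (_  ∷ _)  {Fin.zero}  {Fin.zero}  _ = refl
lookup-injective (x∉ ∷ _)  {Fin.zero}  {Fin.suc j} e = contradiction e (All.lookup x∉ (∈-lookup j))
lookup-injective (x∉ ∷ _)  {Fin.suc i} {Fin.zero}  e = contradiction (sym e) (All.lookup x∉ (∈-lookup i))
lookup-injective (_  ∷ xs!) {Fin.suc i} {Fin.suc j} e = cong Fin.suc (lookup-injective xs! e)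

module Components (G : Graph) where
  open Basics G

  Path : Subset order → Vertex → Vertex → Set
  Path S = Star (AdjIn G S)

  Path-sym : ∀ {S u v} → Path S u v → Path S v u
  Path-sym = reverse λ (u∈S , v∈S , uv) → v∈S , u∈S , adj-sym uv

  Closed : Subset order → Subset order → Set
  Closed S D = ∀ {u v} → u ∈ D → v ∈ S → Adj u v → v ∈ D

  Path-closed : ∀ {S D u v} → Closed S D → u ∈ D → Path S u v → v ∈ D
  Path-closed closed u∈D ε                        = u∈D
  Path-closed closed u∈D ((_ , w∈S , uw) ◅ w⋯v) = Path-closed closed (closed u∈D w∈S uw) w⋯v

  -- Grown from `u` along edges leaving the current set; proper supersets are well-founded on a
  -- finite set, so the growth stops, and it can only stop at a closed set.
  component : ∀ S {u} → u ∈ S →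
    ∃ λ D → u ∈ D × D ⊆ S × (∀ {v} → v ∈ D → Path S u v) × Closed S D
  component S {u} u∈S = grow ⁅ u ⁆ (x∈⁅x⁆ u)
    (λ v∈ → subst (_∈ S) (sym (x∈⁅y⁆⇒x≡y u v∈)) u∈S)
    (λ v∈ → subst (Path S u) (sym (x∈⁅y⁆⇒x≡y u v∈)) ε)
    (⊃-wellFounded ⁅ u ⁆)
    where
    grow : ∀ D → u ∈ D → D ⊆ S → (∀ {v} → v ∈ D → Path S u v) → Acc _⊃_ D →
      ∃ λ D → u ∈ D × D ⊆ S × (∀ {v} → v ∈ D → Path S u v) × Closed S D
    grow D u∈D D⊆S reached (acc rs)
      with any? (λ v → any? (λ w → (v ∈? D) ×-dec (w ∈? S) ×-dec (adj? v w) ×-dec ¬? (w ∈? D)))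
    ... | yes (v , w , v∈D , w∈S , vw , w∉D) =
      grow (D ∪ ⁅ w ⁆) (p⊆p∪q ⁅ w ⁆ u∈D)
        (λ x∈ → either D⊆S w∈S (x∈p∪q⁻ D ⁅ w ⁆ x∈))
        (λ x∈ → either reached (reached v∈D ◅◅ ((D⊆S v∈D , w∈S , vw) ◅ ε)) (x∈p∪q⁻ D ⁅ w ⁆ x∈))
        (rs (p⊆p∪q ⁅ w ⁆ , w , x∈p∪q⁺ (inj₂ (x∈⁅x⁆ w)) , w∉D))
      where
      either : ∀ {P : Vertex → Set} → (∀ {x} → x ∈ D → P x) → P w →
               ∀ {x} → x ∈ D ⊎ x ∈ ⁅ w ⁆ → P x
      either f pw (inj₁ x∈D) = f x∈D
      either {P} f pw (inj₂ x∈w) = subst P (sym (x∈⁅y⁆⇒x≡y w x∈w)) pw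
    ... | no stuck = D , u∈D , D⊆S , reached , closed
      where
      closed : Closed S D
      closed {v} {w} v∈D w∈S vw with w ∈? D
      ... | yes w∈D = w∈D
      ... | no  w∉D = contradiction (v , w , v∈D , w∈S , vw , w∉D) stuck

  component-of : Subset order → Vertex → Subset order
  component-of S u with u ∈? S
  ... | yes u∈S = proj₁ (component S u∈S)
  -- A placeholder that is never listed: `has-components` keeps only vertices of `S`.
  ... | no  _   = Subset.⊥

  component-of-correct : ∀ {S u} → u ∈ S →
    u ∈ component-of S u × IsComponent G S (component-of S u)
  component-of-correct {S} {u} u∈S with u ∈? S
  ... | no  u∉S = contradiction u∈S u∉S
  ... | yes u∈S with component S u∈S
  ...   | D , u∈D , D⊆S , reached , closed = u∈D , (u , u∈D) , D⊆S , λ x∈D y∈S →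
    mk⇔ (λ y∈D → Path-sym (reached x∈D) ◅◅ reached y∈D) (Path-closed closed x∈D)

  component-unique : ∀ {S D E u} → IsComponent G S D → IsComponent G S E → u ∈ D → u ∈ E → D ≡ E
  component-unique (_ , D⊆S , D-path) (_ , E⊆S , E-path) u∈D u∈E = ⊆-antisym
    (λ x∈D → Equivalence.from (E-path u∈E (D⊆S x∈D)) (Equivalence.to (D-path u∈D (D⊆S x∈D)) x∈D))
    (λ x∈E → Equivalence.from (D-path u∈D (E⊆S x∈E)) (Equivalence.to (E-path u∈E (E⊆S x∈E)) x∈E))

  -- Each component is the component of any of its vertices, so the components of all vertices
  -- exhaust the list; removing repetitions makes the indexing injective.
  has-components : ∀ S → ∃ (HasComponents G S)
  has-components S = length Ds , List.lookup Ds , lookup-injective (deduplicate-! _≟ₛ_ candidates) ,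
    sound , complete
    where
    _≟ₛ_ = Vecₚ.≡-dec Bool._≟_
    candidates = map (component-of S) (filter (_∈? S) (allFin order))
    Ds = deduplicate _≟ₛ_ candidates
    sound : ∀ i → IsComponent G S (List.lookup Ds i)
    sound i with ∈-map⁻ (component-of S) (∈-deduplicate⁻ _≟ₛ_ candidates (∈-lookup i))
    ... | u , u∈ , e = subst (IsComponent G S) (sym e)
      (proj₂ (component-of-correct (proj₂ (∈-filter⁻ (_∈? S) {xs = allFin order} u∈))))
    complete : ∀ E → IsComponent G S E → ∃ λ i → List.lookup Ds i ≡ E
    complete E cE@((u , u∈E) , E⊆S , _) = index D∈Ds , trans (sym (lookup-index D∈Ds))
      (component-unique (proj₂ correct) cE (proj₁ correct) u∈E)
      where
      correct = component-of-correct (E⊆S u∈E)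
      D∈Ds = ∈-deduplicate⁺ _≟ₛ_ (∈-map⁺ (component-of S) (∈-filter⁺ (_∈? S) (∈-allFin u) (E⊆S u∈E)))

  -- A path in `S` from `u` never leaves the closed set `D`, so `u` and `v` lie in components with
  -- different indices. `D` may be a union of several components.
  two-components : ∀ {S l D u v} → HasComponents G S l → u ∈ S → v ∈ S → u ∈ D → v ∉ D →
    Closed S D → 1 < l
  two-components {S} {l} {D} {u} {v} (Ds , _ , sound , complete) u∈S v∈S u∈D v∉D closed =
    apart (λ i≡j → v∉D (Path-closed closed u∈D
      (Equivalence.to (proj₂ (proj₂ (proj₂ cu)) (proj₁ cu) v∈S)
        (subst (v ∈_) (sym (same-component i≡j)) (proj₁ cv)))))
    where
    cu = component-of-correct u∈S
    cv = component-of-correct v∈S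
    i = complete _ (proj₂ cu)
    j = complete _ (proj₂ cv)
    same-component : proj₁ i ≡ proj₁ j → component-of S u ≡ component-of S v
    same-component i≡j = trans (sym (proj₂ i)) (trans (cong Ds i≡j) (proj₂ j))
    apart : ∀ {l} {i j : Fin l} → i ≢ j → 1 < l
    apart {suc zero}    {Fin.zero} {Fin.zero} i≢j = contradiction refl i≢j
    apart {suc (suc l)} _ = s≤s (s≤s z≤n)

  one-component : ∀ {k} → Connected G → HasComponents G Subset.⊤ k → k ≤ 1
  one-component {zero}        conn _ = z≤n
  one-component {suc zero}    conn _ = s≤s z≤n
  one-component {suc (suc k)} conn (Ds , injective , sound , _)
    with sound Fin.zero | sound (Fin.suc Fin.zero)
  ... | c₀@((u , u∈D₀) , _ , path₀) | c₁@((v , v∈D₁) , _) =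
    contradiction (injective (component-unique c₀ c₁ v∈D₀ v∈D₁)) λ ()
    where
    v∈D₀ = Equivalence.from (path₀ u∈D₀ ∈⊤) (Star.map (λ uv → ∈⊤ , ∈⊤ , uv) (conn u v))

  clique-cutset : Connected G → ∀ {K D u v} → IsClique G K →
    u ∈ D → u ∉ K → v ∉ D → v ∉ K → Closed (∁ K) D → HasCliqueCutset G
  clique-cutset conn {K} clique u∈D u∉K v∉D v∉K closed
    with has-components Subset.⊤ | has-components (∁ K)
  ... | k , ck | l , cl = K , clique , k , l , ck , cl ,
    ≤-<-trans (one-component conn ck)
      (two-components cl (x∉p⇒x∈∁p u∉K) (x∉p⇒x∈∁p v∉K) u∈D v∉D closed)

-- The case analysis at a claw

least : ∀ {P : ℕ → Set} → Decidable P → ∃ P → ∃ λ n → P n × (∀ {m} → m < n → ¬ P m)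
least {P} P? (n , pn) = go n pn (<-wellFounded n)
  where
  go : ∀ n → P n → Acc _<_ n → ∃ λ n → P n × (∀ {m} → m < n → ¬ P m)
  go n pn (acc rs) with anyUpTo? P? n
  ... | yes (m , m<n , pm) = go m pm (rs m<n)
  ... | no  none           = n , pn , λ m<n pm → none (_ , m<n , pm)

module Walks (G : Graph) (r : Graph.Vertex G) where
  open Basics G

  Away : Vertex → Set
  Away = Sep r

  away? : Decidable Away
  away? v = ¬? (r Fin.≟ v) ×-dec ¬? (adj? r v)

  -- Some walk of exactly `k` steps, not a distance; minimality is imposed in `Walk`.
  Reach : List Vertex → ℕ → Vertex → Set
  Reach L zero    y = Away y × Any (Adj y) L
  Reach L (suc k) y = Away y × ∃ λ z → Adj y z × Reach L k z

  reach? : ∀ L k → Decidable (Reach L k)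
  reach? L zero    y = away? y ×-dec Any.any? (adj? y) L
  reach? L (suc k) y = away? y ×-dec any? λ z → adj? y z ×-dec reach? L k z

  Reach⇒Away : ∀ {L} k {y} → Reach L k y → Away y
  Reach⇒Away zero    = proj₁
  Reach⇒Away (suc k) = proj₁

  -- x is the last vertex and xs the earlier ones of a shortest walk through
  -- non-neighbours of r towards a neighbour of L, with δ + 1 steps to go.
  Walk : Vertex → List Vertex → List Vertex → Set
  Walk x xs L = All (Sep x) L × ∃ λ δ →
    (∃ λ y → Adj x y × Reach L δ y) ×
    (∀ {j} → j < δ → ¬ ∃ λ y → Adj x y × Reach L j y) ×
    All (λ z → ∀ j y → j ≤ δ → Reach L j y → Sep z y) xs

  Joined : Vertex → Set
  Joined x = ∃ λ y → Away y × Adj x y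

  -- The next vertex `y` lies on a walk of minimal length. When it still misses `L`, the walk from
  -- `y` inherits minimality, since a shortcut from `y` would be one from `x`.
  advance : ∀ {x xs L} {Q : Set} → Walk x xs L →
    (∀ y → Adj x y → Away y → All (λ z → Sep z y) xs →
           (All (Sep y) L → Walk y (x ∷ xs) L) → Q) → Q
  advance {x} {xs} {L} (x∉L , δ , (y , xy , δy) , min , xs-far) k =
    k y xy (Reach⇒Away δ δy) (All.map (λ f → f δ y ≤-refl δy) xs-far) (next δ min δy xs-far)
    where
    next : ∀ δ → (∀ {j} → j < δ → ¬ ∃ λ y → Adj x y × Reach L j y) → Reach L δ y →
           All (λ z → ∀ j y → j ≤ δ → Reach L j y → Sep z y) xs →
           All (Sep y) L → Walk y (x ∷ xs) L
    next zero min (_ , hit) _ y∉L = contradiction hit (Allₚ.All¬⇒¬Any (All.map proj₂ y∉L))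
    next (suc δ) min (away , z , yz , δz) xs-far y∉L =
      y∉L , δ , (z , yz , δz) ,
      (λ j<δ (w , yw , jw) → min (s<s j<δ) (y , xy , away , w , yw , jw)) ,
      (λ j w j≤δ jw → (λ { refl → not-x j (s≤s j≤δ) jw }) , λ xw → min (s≤s j≤δ) (w , xw , jw)) ∷
      All.map (λ f j w j≤δ → f j w (m≤n⇒m≤1+n j≤δ)) xs-far
      where
      -- If `x` could itself be reached from `L` this early, it would see `L` or have a neighbour
      -- even closer, against minimality.
      not-x : ∀ j → j < suc δ → ¬ Reach L j x
      not-x zero    _     (_ , hit)        = Allₚ.All¬⇒¬Any (All.map proj₂ x∉L) hit
      not-x (suc j) j<δ (_ , w , xw , jw) = min (<-trans (n<1+n j) j<δ) (w , xw , jw)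

  AwayStep : Vertex → Vertex → Set
  AwayStep u v = Adj u v × Away v

  start : (∀ {x y} → Away x → Away y → Star AwayStep x y) →
    ∀ {x l L} → Joined x → Joined l → All (Sep x) (l ∷ L) → Walk x [] (l ∷ L)
  start linked {x} {l} {L} (y , ry , xy) (z , rz , lz) x∉L
    with least (λ k → any? λ y → adj? x y ×-dec reach? (l ∷ L) k y) (reached ry (linked ry rz))
    where
    along : ∀ {y} → Away y → Star AwayStep y z → ∃ λ k → Reach (l ∷ L) k y
    along ry ε                 = 0 , ry , here (adj-sym lz)
    along ry ((yw , rw) ◅ w⋯z) with along rw w⋯z
    ... | k , kw = suc k , ry , _ , yw , kw
    reached : Away y → Star AwayStep y z → ∃ λ k → ∃ λ y → Adj x y × Reach (l ∷ L) k y
    reached ry y⋯z with along ry y⋯z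
    ... | k , ky = k , y , xy , ky
  ... | δ , reach , min = x∉L , δ , reach , min , []

-- An induced subgraph of the Petersen graph: a vertex, its three neighbours, and three consecutive
-- vertices of the 6-cycle formed by its non-neighbours. Several branches at the claw end here, so
-- it is settled once.
claw-with-path : Graph
claw-with-path = edgeGraph {7}
  ( (# 0 , # 1) ∷ (# 0 , # 2) ∷ (# 0 , # 3) ∷ (# 1 , # 4) ∷ (# 2 , # 5) ∷ (# 3 , # 6)
  ∷ (# 4 , # 5) ∷ (# 5 , # 6) ∷ [])

-- Indices into the known configurations: basic below, followed by claw-with-path.
c4 : ℕ → ℕ → ℕ → ℕ → Tree
c4 a b c d = cite 0 (a ∷ b ∷ c ∷ d ∷ [])

gm : ℕ → ℕ → ℕ → ℕ → ℕ → Tree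
gm a b c d e = cite 1 (a ∷ b ∷ c ∷ d ∷ e ∷ [])

p7 c7 t2 : ℕ → ℕ → ℕ → ℕ → ℕ → ℕ → ℕ → Tree
p7 a b c d e f g = cite 2 (a ∷ b ∷ c ∷ d ∷ e ∷ f ∷ g ∷ [])
c7 a b c d e f g = cite 3 (a ∷ b ∷ c ∷ d ∷ e ∷ f ∷ g ∷ [])
t2 a b c d e f g = cite 6 (a ∷ b ∷ c ∷ d ∷ e ∷ f ∷ g ∷ [])

gd : ℕ → ℕ → ℕ → ℕ → Tree
gd a b c d = cite 4 (a ∷ b ∷ c ∷ d ∷ [])

pt : ℕ → ℕ → ℕ → ℕ → ℕ → ℕ → ℕ → ℕ → ℕ → ℕ → Tree
pt a b c d e f g h i j = cite 5 (a ∷ b ∷ c ∷ d ∷ e ∷ f ∷ g ∷ h ∷ i ∷ j ∷ [])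

-- Found by computer search.
path-tree claw-tree : Tree
path-tree =
  fork 2 0 5 7 (split 7 1 0 (c4 7 1 0 2) (split 7 3 0 (c4 7 2 0 3) (split 7 4 1 (c4 7 2 5 4)
  (split 7 6 2 (c4 7 2 5 6) (fork 1 0 4 8 (split 8 2 0 (c4 8 1 0 2) (split 8 3 0 (c4 8 1 0 3)
  (split 8 5 1 (c4 8 1 4 5) (split 8 6 1 (split 8 7 1 (fork 3 0 6 9 (split 9 1 0 (c4 9 1 0 3)
  (split 9 2 0 (c4 9 2 0 3) (split 9 5 2 (c4 9 3 6 5) (split 9 8 1 (c4 9 3 6 8) (split 9 4 1
  (split 9 7 2 (pt 9 3 0 1 4 7 6 2 8 5) (p7 3 9 4 1 8 7 2)) (fork 4 1 5 10 (split 10 0 1 (c4 10 0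
  1 4) (split 10 2 0 (c4 10 2 5 4) (split 10 6 4 (c4 10 4 5 6) (split 10 8 1 (c4 10 4 1 8) (split
  10 3 0 (split 10 7 2 (pt 10 3 0 1 4 7 6 2 8 5) (p7 3 10 4 1 8 7 2)) (split 10 9 3 (c7 10 4 1 8 6
  3 9) (p7 10 4 1 8 6 3 9))))))) (split 10 2 4 (c4 10 2 5 4) (split 10 0 2 (split 11 0 4 (c4 11 0
  10 4) (gm 11 4 10 0 1)) (split 10 3 0 (c4 10 1 0 3) (split 10 9 3 (c7 10 4 5 2 0 3 9) (p7 10 4 5
  2 0 3 9))))) (split 10 0 1 (c4 10 0 1 4) (split 10 8 1 (c4 10 4 1 8) (split 10 2 0 (split 11 2 4
  (c4 11 2 10 4) (gm 11 4 10 2 5)) (split 10 7 2 (c4 10 5 2 7) (split 10 3 0 (p7 3 10 4 1 8 7 2)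
  (split 10 6 3 (p7 4 10 6 3 0 2 7) (split 10 9 3 (c7 10 4 1 8 6 3 9) (p7 10 4 1 8 6 3
  9)))))))))))))) (gd 0 3 9 10) (split 9 1 0 (c4 9 1 0 3) (split 9 2 0 (c4 9 2 0 3) (split 9 4 1
  (split 9 5 3 (gm 4 5 6 3 9) (c4 9 4 5 6)) (split 9 7 2 (p7 6 9 7 2 0 1 4) (split 9 5 2 (split 10
  5 3 (c4 10 3 9 5) (gm 10 3 9 5 6)) (split 9 8 1 (p7 3 9 8 1 4 5 2) (fork 4 1 5 11 (split 11 0 1
  (c4 11 0 1 4) (split 11 2 0 (c4 11 2 5 4) (split 11 6 4 (c4 11 4 5 6) (split 11 8 1 (c4 11 4 1
  8) (split 11 9 4 (p7 11 9 6 5 2 0 1) (split 11 3 0 (split 11 7 2 (pt 11 3 0 1 4 7 6 2 8 5) (p7 3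
  11 4 1 8 7 2)) (p7 11 4 5 2 0 3 9))))))) (split 11 2 1 (c4 11 2 5 4) (split 11 6 1 (c4 11 4 5 6)
  (split 11 0 2 (split 12 0 4 (c4 12 0 11 4) (gm 12 4 11 0 1)) (split 11 9 1 (c7 11 1 0 2 5 6 9)
  (p7 11 1 0 2 5 6 9))))) (split 11 0 1 (c4 11 0 1 4) (split 11 8 1 (c4 11 4 1 8) (split 11 3 0
  (split 11 6 4 (gm 4 5 6 3 11) (c4 11 3 6 5)) (split 11 7 5 (p7 5 11 7 8 1 0 3) (split 11 9 3 (p7
  11 9 3 0 1 8 7) (split 11 2 0 (split 12 2 4 (c4 12 2 11 4) (gm 12 4 11 2 5)) (fork 7 2 8 13
  (split 13 0 2 (c4 13 0 2 7) (split 13 1 0 (c4 13 1 8 7) (split 13 5 2 (c4 13 5 2 7) (split 13 6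
  5 (c4 13 6 8 7) (split 13 9 6 (p7 13 9 6 5 2 0 1) (split 13 3 0 (split 13 11 3 (p7 13 11 5 2 0 1
  8) (p7 9 3 13 7 2 5 11)) (p7 13 7 8 1 0 3 9))))))) (split 13 1 2 (c4 13 1 8 7) (split 13 6 2 (c4
  13 6 8 7) (split 13 0 1 (split 14 0 7 (c4 14 0 13 7) (gm 14 7 13 0 2)) (split 13 9 2 (c7 13 2 0
  1 8 6 9) (p7 13 2 0 1 8 6 9))))) (split 13 0 2 (c4 13 0 2 7) (split 13 5 2 (c4 13 5 2 7) (split
  13 1 0 (split 14 1 7 (c4 14 1 13 7) (gm 14 7 13 1 8)) (split 13 11 5 (c7 13 8 1 0 2 5 11) (p7 13
  8 1 0 2 5 11)))))))))))))))))))) (fork 3 0 6 9 (split 9 1 0 (c4 9 1 0 3) (split 9 2 0 (c4 9 2 0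
  3) (split 9 5 2 (c4 9 3 6 5) (split 9 8 1 (c4 9 3 6 8) (split 9 7 2 (p7 9 7 2 0 1 8 6) (split 9
  4 1 (fork 8 1 6 10 (split 10 0 1 (c4 10 0 1 8) (split 10 3 0 (c4 10 3 6 8) (split 10 4 1 (c4 10
  4 1 8) (split 10 5 4 (c4 10 5 6 8) (split 10 2 0 (split 10 9 2 (pt 10 2 0 1 8 9 5 3 4 6) (p7 2
  10 8 1 4 9 3)) (split 10 7 2 (c7 10 7 2 0 3 6 8) (p7 10 8 1 4 5 2 7))))))) (split 10 3 6 (c4 10
  3 6 8) (split 10 0 3 (split 11 0 8 (c4 11 0 10 8) (gm 11 8 10 0 1)) (split 10 2 0 (c4 10 1 0 2)
  (split 10 7 2 (c7 10 7 2 0 3 6 8) (p7 10 8 6 3 0 2 7))))) (split 10 0 1 (c4 10 0 1 8) (split 10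
  4 1 (c4 10 4 1 8) (split 10 2 0 (split 10 5 8 (gm 2 5 6 8 10) (c4 10 2 5 6)) (split 10 7 2 (p7 6
  10 7 2 0 1 4) (split 10 5 2 (split 10 9 4 (c4 10 5 4 9) (split 10 3 0 (split 11 3 8 (c4 11 3 10
  8) (gm 11 8 10 3 6)) (p7 5 10 8 1 0 3 9))) (p7 10 8 1 4 5 2 7))))))) (fork 4 1 5 10 (split 10 0
  1 (c4 10 0 1 4) (split 10 2 0 (c4 10 2 5 4) (split 10 6 4 (c4 10 4 5 6) (split 10 8 1 (c4 10 4 1
  8) (split 10 7 2 (p7 10 7 2 0 1 8 6) (split 10 9 4 (p7 9 10 4 1 0 2 7) (split 10 3 4 (p7 9 3 10
  4 5 2 7) (p7 10 4 1 8 6 3 9)))))))) (split 10 2 4 (c4 10 2 5 4) (split 10 0 2 (split 11 0 4 (c4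
  11 0 10 4) (gm 11 4 10 0 1)) (split 10 3 0 (c4 10 1 0 3) (split 10 9 3 (c7 10 4 5 2 0 3 9) (p7
  10 4 5 2 0 3 9))))) (split 10 0 1 (c4 10 0 1 4) (split 10 8 1 (c4 10 4 1 8) (split 10 2 0 (split
  11 2 4 (c4 11 2 10 4) (gm 11 4 10 2 5)) (split 10 7 2 (c4 10 5 2 7) (split 10 6 4 (p7 10 6 8 1 0
  2 7) (split 10 3 4 (c4 10 3 6 5) (split 10 9 3 (c7 10 4 1 8 6 3 9) (p7 10 4 1 8 6 3
  9))))))))))))))) (gd 0 3 9 10) (split 9 1 0 (c4 9 1 0 3) (split 9 2 0 (c4 9 2 0 3) (split 9 4 1
  (split 9 5 3 (gm 4 5 6 3 9) (c4 9 4 5 6)) (split 9 7 2 (p7 6 9 7 2 0 1 4) (split 9 8 1 (split 9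
  5 2 (split 10 5 3 (c4 10 3 9 5) (gm 10 3 9 5 6)) (p7 9 8 1 4 5 2 7)) (p7 9 6 8 1 0 2 7))))))))
  (split 8 7 1 (p7 1 8 7 2 5 6 3) (fork 3 0 6 9 (split 9 1 0 (c4 9 1 0 3) (split 9 2 0 (c4 9 2 0
  3) (split 9 5 2 (c4 9 3 6 5) (split 9 8 1 (p7 9 8 1 0 2 5 6) (split 9 4 1 (split 9 7 2 (fork 6 3
  5 10 (split 10 0 3 (c4 10 0 3 6) (split 10 2 0 (c4 10 2 5 6) (split 10 4 5 (c4 10 4 5 6) (split
  10 9 3 (c4 10 6 3 9) (split 10 1 0 (split 10 7 1 (pt 10 1 0 3 6 7 4 2 9 5) (p7 1 10 6 3 9 7 2))
  (split 10 8 1 (c7 10 6 3 9 4 1 8) (p7 10 6 3 9 4 1 8))))))) (split 10 2 5 (c4 10 2 5 6) (split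
  10 0 2 (split 11 0 6 (c4 11 0 10 6) (gm 11 6 10 0 3)) (split 10 1 0 (c4 10 1 0 3) (split 10 8 1
  (c7 10 6 5 2 0 1 8) (p7 10 6 5 2 0 1 8))))) (split 10 0 3 (c4 10 0 3 6) (split 10 9 3 (c4 10 6 3
  9) (split 10 1 0 (split 10 4 6 (gm 1 4 5 6 10) (c4 10 1 4 5)) (split 10 7 5 (p7 5 10 7 9 3 0 1)
  (split 10 8 1 (p7 10 8 1 0 3 9 7) (split 10 4 1 (split 10 2 0 (split 11 2 6 (c4 11 2 10 6) (gm
  11 6 10 2 5)) (p7 4 10 6 3 0 2 7)) (p7 10 6 3 9 4 1 8)))))))) (fork 6 3 5 10 (split 10 0 3 (c4
  10 0 3 6) (split 10 2 0 (c4 10 2 5 6) (split 10 4 5 (c4 10 4 5 6) (split 10 9 3 (c4 10 6 3 9)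
  (split 10 7 2 (p7 10 7 2 0 3 9 4) (split 10 8 6 (p7 8 10 6 3 0 2 7) (split 10 1 4 (p7 8 1 10 6 5
  2 7) (p7 10 6 3 9 4 1 8)))))))) (split 10 2 5 (c4 10 2 5 6) (split 10 0 2 (split 11 0 6 (c4 11 0
  10 6) (gm 11 6 10 0 3)) (split 10 1 0 (c4 10 1 0 3) (split 10 8 1 (c7 10 6 5 2 0 1 8) (p7 10 6 5
  2 0 1 8))))) (split 10 0 3 (c4 10 0 3 6) (split 10 9 3 (c4 10 6 3 9) (split 10 1 0 (split 10 4 6
  (gm 1 4 5 6 10) (c4 10 1 4 5)) (split 10 8 1 (p7 5 10 8 1 0 3 9) (split 10 4 1 (split 10 7 4 (p7
  7 10 6 3 0 1 8) (split 10 2 0 (split 11 2 6 (c4 11 2 10 6) (gm 11 6 10 2 5)) (p7 10 4 9 3 0 2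
  7))) (p7 10 6 3 9 4 1 8)))))))) (p7 9 3 6 5 4 1 8)))))) (gd 0 3 9 10) (split 9 1 0 (c4 9 1 0 3)
  (split 9 2 0 (c4 9 2 0 3) (split 9 4 1 (split 9 5 3 (gm 4 5 6 3 9) (c4 9 4 5 6)) (split 9 7 2
  (p7 6 9 7 2 0 1 4) (split 9 8 1 (p7 6 9 8 1 0 2 7) (split 9 5 2 (split 10 5 3 (c4 10 3 9 5) (gm
  10 3 9 5 6)) (p7 9 6 5 2 0 1 8))))))))))))) (gd 0 1 8 9) (split 8 2 0 (c4 8 1 0 2) (split 8 3 0
  (c4 8 1 0 3) (split 8 6 1 (split 8 5 1 (gm 1 4 5 6 8) (c4 8 4 5 6)) (split 8 7 1 (p7 4 8 7 2 0 3
  6) (split 8 5 1 (split 9 5 1 (c4 9 1 8 5) (gm 9 1 8 5 4)) (fork 3 0 6 10 (split 10 1 0 (c4 10 1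
  0 3) (split 10 2 0 (c4 10 2 0 3) (split 10 5 2 (c4 10 3 6 5) (split 10 8 1 (p7 10 8 1 0 2 5 6)
  (split 10 4 1 (split 10 7 2 (fork 6 3 5 11 (split 11 0 3 (c4 11 0 3 6) (split 11 2 0 (c4 11 2 5
  6) (split 11 4 5 (c4 11 4 5 6) (split 11 8 4 (p7 11 8 4 5 2 0 3) (split 11 1 0 (split 11 7 1
  (split 11 10 1 (c4 11 1 4 10) (pt 11 1 0 3 6 7 4 2 10 5)) (p7 8 1 11 6 5 2 7)) (p7 11 6 5 2 0 1
  8)))))) (split 11 2 3 (c4 11 2 5 6) (split 11 4 3 (c4 11 4 5 6) (split 11 0 2 (split 12 0 6 (c4
  12 0 11 6) (gm 12 6 11 0 3)) (split 11 8 3 (c7 11 3 0 2 5 4 8) (p7 11 3 0 2 5 4 8))))) (split 11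
  0 3 (c4 11 0 3 6) (split 11 10 3 (c4 11 6 3 10) (split 11 1 0 (split 11 4 6 (gm 1 4 5 6 11) (c4
  11 1 4 5)) (split 11 7 5 (p7 5 11 7 10 3 0 1) (split 11 8 1 (p7 11 8 1 0 3 10 7) (split 11 2 0
  (split 12 2 6 (c4 12 2 11 6) (gm 12 6 11 2 5)) (fork 7 2 10 13 (split 13 0 2 (c4 13 0 2 7)
  (split 13 3 0 (c4 13 3 10 7) (split 13 4 7 (c4 13 4 10 7) (split 13 5 2 (c4 13 5 2 7) (split 13
  8 4 (p7 13 8 4 5 2 0 3) (split 13 1 0 (split 13 11 1 (p7 13 11 5 2 0 3 10) (p7 8 1 13 7 2 5 11))
  (p7 13 7 10 3 0 1 8))))))) (split 13 3 2 (c4 13 3 10 7) (split 13 4 2 (c4 13 4 10 7) (split 13 0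
  3 (split 14 0 7 (c4 14 0 13 7) (gm 14 7 13 0 2)) (split 13 8 2 (c7 13 2 0 3 10 4 8) (p7 13 2 0 3
  10 4 8))))) (split 13 0 2 (c4 13 0 2 7) (split 13 5 2 (c4 13 5 2 7) (split 13 1 0 (split 13 4 7
  (gm 1 4 10 7 13) (c4 13 1 4 10)) (split 13 6 5 (p7 10 13 6 5 2 0 1) (split 13 8 1 (p7 13 8 1 0 2
  5 6) (split 13 11 5 (p7 13 11 5 2 0 1 8) (split 13 3 0 (split 14 3 7 (c4 14 3 13 7) (gm 14 7 13
  3 10)) (p7 13 7 2 0 3 6 11)))))))))))))))) (p7 8 4 10 3 0 2 7)) (p7 10 3 0 2 5 4 8)))))) (gd 0 3
  10 11) (split 10 1 0 (c4 10 1 0 3) (split 10 2 0 (c4 10 2 0 3) (split 10 4 1 (split 10 5 3 (gm 4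
  5 6 3 10) (c4 10 4 5 6)) (split 10 7 2 (p7 6 10 7 2 0 1 4) (split 10 8 1 (p7 6 10 8 1 0 2 7)
  (split 10 5 2 (split 11 5 3 (c4 11 3 10 5) (gm 11 3 10 5 6)) (p7 10 3 0 2 5 4
  8)))))))))))))))))) (gd 0 2 7 8) (split 7 1 0 (c4 7 1 0 2) (split 7 3 0 (c4 7 2 0 3) (split 7 4
  1 (split 8 4 2 (c4 8 2 7 4) (gm 8 2 7 4 5)) (split 7 6 2 (split 8 6 2 (c4 8 2 7 6) (gm 8 2 7 6
  5)) (fork 1 0 4 9 (split 9 2 0 (c4 9 1 0 2) (split 9 3 0 (c4 9 1 0 3) (split 9 5 1 (c4 9 1 4 5)
  (split 9 6 1 (split 9 7 1 (c4 9 6 5 7) (fork 3 0 6 10 (split 10 1 0 (c4 10 1 0 3) (split 10 2 0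
  (c4 10 2 0 3) (split 10 5 2 (c4 10 3 6 5) (split 10 9 1 (c4 10 3 6 9) (split 10 7 2 (p7 10 7 2 0
  1 9 6) (split 10 4 1 (fork 9 1 6 11 (split 11 0 1 (c4 11 0 1 9) (split 11 3 0 (c4 11 3 6 9)
  (split 11 4 1 (c4 11 4 1 9) (split 11 5 4 (c4 11 5 6 9) (split 11 7 5 (p7 11 7 5 4 1 0 3) (split
  11 2 0 (split 11 10 2 (pt 11 2 0 1 9 10 5 3 4 6) (p7 2 11 9 1 4 10 3)) (p7 11 9 6 3 0 2 7)))))))
  (split 11 3 1 (c4 11 3 6 9) (split 11 5 1 (c4 11 5 6 9) (split 11 0 3 (split 12 0 9 (c4 12 0 11
  9) (gm 12 9 11 0 1)) (split 11 7 1 (c7 11 1 0 3 6 5 7) (p7 11 1 0 3 6 5 7))))) (split 11 0 1 (c4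
  11 0 1 9) (split 11 4 1 (c4 11 4 1 9) (split 11 2 0 (split 11 5 9 (gm 2 5 6 9 11) (c4 11 2 5 6))
  (split 11 7 2 (p7 6 11 7 2 0 1 4) (split 11 10 4 (p7 11 10 4 1 0 2 7) (split 11 3 0 (split 12 3
  9 (c4 12 3 11 9) (gm 12 9 11 3 6)) (fork 10 3 4 13 (split 13 0 3 (c4 13 0 3 10) (split 13 1 0
  (c4 13 1 4 10) (split 13 5 4 (c4 13 5 4 10) (split 13 6 3 (c4 13 6 3 10) (split 13 7 5 (p7 13 7
  5 4 1 0 3) (split 13 2 0 (split 13 11 2 (p7 13 11 6 3 0 1 4) (p7 7 2 13 10 3 6 11)) (p7 13 10 4
  1 0 2 7))))))) (split 13 1 3 (c4 13 1 4 10) (split 13 5 3 (c4 13 5 4 10) (split 13 0 1 (split 14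
  0 10 (c4 14 0 13 10) (gm 14 10 13 0 3)) (split 13 7 3 (c7 13 3 0 1 4 5 7) (p7 13 3 0 1 4 5
  7))))) (split 13 0 3 (c4 13 0 3 10) (split 13 6 3 (c4 13 6 3 10) (split 13 1 0 (split 14 1 10
  (c4 14 1 13 10) (gm 14 10 13 1 4)) (split 13 11 4 (c7 13 4 1 0 3 6 11) (p7 13 4 1 0 3 6
  11))))))))))))) (p7 10 3 0 1 4 5 7))))))) (gd 0 3 10 11) (split 10 1 0 (c4 10 1 0 3) (split 10 2
  0 (c4 10 2 0 3) (split 10 4 1 (split 10 5 3 (gm 4 5 6 3 10) (c4 10 4 5 6)) (split 10 7 2 (p7 6
  10 7 2 0 1 4) (split 10 5 3 (split 11 5 3 (c4 11 3 10 5) (gm 11 3 10 5 6)) (p7 10 3 0 1 4 5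
  7)))))))) (split 9 7 1 (c7 9 1 0 3 6 5 7) (p7 9 1 0 3 6 5 7)))))) (gd 0 1 9 10) (split 9 3 0 (c4
  9 1 0 3) (split 9 5 1 (split 10 5 1 (c4 10 1 9 5) (gm 10 1 9 5 4)) (split 9 6 1 (c4 9 4 5 6)
  (split 9 7 1 (c4 9 4 5 7) (p7 9 1 0 3 6 5 7))))))))))
claw-tree =
  begin 2 1 ([]) (step 4 (split 4 1 0 (c4 4 1 0 2) (split 4 3 0 (c4 4 2 0 3) (step 5 (split 5 1 0
  (split 5 3 0 (c4 5 1 0 3) (begin 3 4 (5 ∷ []) (step 6 (split 6 4 3 (split 6 1 0 (c4 6 1 0 3)
  (split 6 2 0 (c4 6 2 0 3) (split 6 5 1 (fork 1 0 5 7 (split 7 2 0 (c4 7 1 0 2) (split 7 3 0 (c4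
  7 1 0 3) (split 7 4 1 (c4 7 1 5 4) (split 7 6 1 (c4 7 1 5 6) (fork 2 0 4 8 (split 8 1 0 (c4 8 1
  0 2) (split 8 3 0 (c4 8 2 0 3) (split 8 5 1 (c4 8 2 4 5) (split 8 6 2 (c4 8 2 4 6) (split 8 7 1
  (p7 8 7 1 0 3 6 4) (begin 7 4 (5 ∷ 6 ∷ 8 ∷ []) (step 9 (split 9 4 7 (split 9 1 0 (split 9 5 7
  (gm 7 1 5 4 9) (c4 9 1 5 4)) (split 9 5 1 (c4 9 5 1 7) (split 9 2 0 (split 9 3 0 (c4 9 2 0 3)
  (split 9 6 2 (gm 5 6 9 2 4) (c7 9 4 6 3 0 1 7))) (split 9 8 2 (c4 9 4 2 8) (split 9 6 5 (p7 9 6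
  5 1 0 2 8) (split 9 3 0 (c4 9 3 6 4) (c7 9 4 6 3 0 1 7))))))) (split 9 5 4 (split 9 1 0 (split 9
  2 0 (c4 9 1 0 2) (split 9 3 0 (c4 9 1 0 3) (p7 7 9 5 4 2 0 3))) (c4 9 5 1 7)) (split 9 6 4
  (split 9 1 0 (c4 9 1 5 6) (split 9 2 0 (c4 9 2 4 6) (c7 9 6 4 2 0 1 7))) (split 9 8 7 (split 9 1
  0 (split 9 3 0 (c4 9 1 0 3) (p7 8 9 1 0 3 6 4)) (split 9 3 0 (p7 8 9 3 0 1 5 4) (p7 9 7 1 0 3 6
  4))) (split 9 1 0 (split 9 2 0 (c4 9 1 0 2) (split 9 3 0 (c4 9 1 0 3) (step 10 (split 10 4 9
  (split 10 2 0 (split 10 1 0 (c4 10 1 0 2) (split 10 3 0 (c4 10 2 0 3) (split 10 6 2 (split 10 5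
  1 (c4 10 5 1 9) (gm 5 6 10 2 4)) (c7 10 4 6 3 0 1 9)))) (split 10 3 0 (split 10 8 2 (c4 10 4 2
  8) (p7 7 9 10 3 0 2 8)) (p7 7 9 10 4 2 0 3))) (split 10 5 4 (split 10 1 7 (gm 7 9 10 5 1) (c4 10
  5 1 9)) (split 10 6 4 (split 10 2 0 (c4 10 2 4 6) (p7 7 9 10 6 4 2 0)) (split 10 8 9 (split 10 2
  0 (split 10 3 0 (c4 10 2 0 3) (p7 9 10 2 0 3 6 5)) (p7 7 9 10 8 2 4 5)) (split 10 1 0 (split 10
  2 0 (c4 10 1 0 2) (split 10 3 0 (c4 10 1 0 3) (step 11 (split 11 4 10 (split 11 2 0 (split 11 3
  0 (c4 11 2 0 3) (p7 3 0 2 11 10 9 7)) (p7 0 2 4 11 10 9 7)) (split 11 5 4 (split 11 1 7 (gm 7 9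
  10 11 1) (c4 11 5 1 10)) (split 11 6 4 (split 11 2 0 (c4 11 2 4 6) (p7 9 10 11 6 4 2 0)) (split
  11 8 10 (split 11 2 4 (p7 5 4 2 11 10 9 7) (p7 9 10 11 8 2 4 5)) (split 11 1 0 (gm 7 9 10 11 1)
  (split 11 2 0 (p7 8 2 11 10 1 5 6) (p7 11 10 1 0 2 4 6)))))))))) (split 10 2 0 (p7 8 2 10 9 1 5
  6) (p7 10 9 1 0 2 4 6)))))))))) (split 9 2 0 (p7 8 2 9 7 1 5 6) (p7 9 7 1 0 2 4 6))))))))))))))
  (gd 0 2 8 9) (split 8 1 0 (c4 8 1 0 2) (split 8 3 0 (c4 8 2 0 3) (split 8 5 2 (split 9 5 2 (c4 9
  2 8 5) (gm 9 2 8 5 4)) (split 8 6 2 (gm 5 6 8 2 4) (split 8 7 1 (c7 8 4 6 3 0 1 7) (p7 8 4 6 3 0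
  1 7))))))))))) (gd 0 1 7 8) (split 7 2 0 (c4 7 1 0 2) (split 7 3 0 (c4 7 1 0 3) (split 7 4 1
  (split 8 4 1 (c4 8 1 7 4) (gm 8 1 7 4 5)) (split 7 6 1 (gm 4 6 7 1 5) (fork 2 0 4 9 (split 9 3 0
  (c4 9 2 0 3) (split 9 5 2 (c4 9 2 4 5) (split 9 6 2 (c4 9 2 4 6) (split 9 7 2 (c7 9 2 0 3 6 5 7)
  (p7 9 2 0 3 6 5 7))))) (gd 0 2 9 10) (split 9 3 0 (c4 9 2 0 3) (split 9 5 2 (split 10 5 2 (c4 10
  2 9 5) (gm 10 2 9 5 4)) (split 9 6 2 (gm 5 6 9 2 4) (split 9 7 2 (c4 9 4 5 7) (p7 9 2 0 3 6 5
  7))))))))))) (t2 0 1 2 3 5 4 6)))) (split 6 5 3 (split 6 1 0 (c4 6 1 0 3) (split 6 2 0 (c4 6 2 0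
  3) (t2 0 2 1 3 4 5 6))) (split 6 1 0 (c4 6 1 0 3) (split 6 2 0 (c4 6 2 0 3) (step 7 (split 7 4 6
  (split 7 5 6 (split 7 1 0 (split 7 2 0 (c4 7 1 0 2) (t2 0 2 1 3 4 7 6)) (split 7 2 0 (t2 0 1 2 3
  5 7 6) (fork 1 0 5 8 (split 8 2 0 (c4 8 1 0 2) (split 8 3 0 (c4 8 1 0 3) (split 8 4 1 (c4 8 1 5
  4) (split 8 6 1 (p7 8 6 3 0 2 4 5) (split 8 7 1 (c4 8 1 5 7) (p7 8 1 0 2 4 7 6)))))) (gd 0 1 8
  9) (split 8 2 0 (c4 8 1 0 2) (split 8 3 0 (c4 8 1 0 3) (split 8 4 1 (split 9 4 1 (c4 9 1 8 4)
  (gm 9 1 8 4 5)) (split 8 6 3 (c7 8 5 4 2 0 3 6) (p7 8 5 4 2 0 3 6)))))))) (split 7 1 0 (c4 7 1 5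
  4) (c7 7 4 5 1 0 3 6))) (split 7 5 4 (split 7 2 0 (c4 7 2 4 5) (c7 7 5 4 2 0 3 6)) (split 7 2 0
  (split 7 1 0 (c4 7 1 0 2) (p7 7 6 3 0 1 5 4)) (p7 7 6 3 0 2 4 5)))))))))))) (split 5 3 0 (step 6
  (split 6 1 0 (split 6 3 0 (c4 6 1 0 3) (t2 0 1 3 2 6 5 4)) (step 7 (split 7 1 0 (c7 7 1 0 2 4 5
  6) (p7 7 6 5 4 2 0 1))))) (step 6 (split 6 1 0 (split 6 3 0 (c4 6 1 0 3) (begin 3 4 (5 ∷ 6 ∷ [])
  (step 7 (split 7 4 3 (split 7 1 0 (c4 7 1 0 3) (split 7 2 0 (c4 7 2 0 3) (split 7 5 3 (split 7 6
  1 (t2 0 1 3 2 6 7 4) (fork 2 0 4 8 (split 8 1 0 (c4 8 1 0 2) (split 8 3 0 (c4 8 2 0 3) (split 8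
  5 2 (c4 8 2 4 5) (split 8 7 2 (c4 8 2 4 7) (split 8 6 1 (c7 8 2 0 3 7 5 6) (p7 8 2 0 1 6 5
  7)))))) (gd 0 2 8 9) (split 8 1 0 (c4 8 1 0 2) (split 8 3 0 (c4 8 2 0 3) (split 8 5 2 (split 9 5
  2 (c4 9 2 8 5) (gm 9 2 8 5 4)) (split 8 6 1 (c4 8 4 5 6) (p7 8 4 5 6 1 0 3))))))) (split 7 6 1
  (c4 7 4 5 6) (c7 7 3 0 1 6 5 4))))) (split 7 5 3 (split 7 1 0 (c4 7 1 0 3) (split 7 2 0 (c4 7 2
  0 3) (fork 1 0 6 8 (split 8 2 0 (c4 8 1 0 2) (split 8 3 0 (c4 8 1 0 3) (split 8 5 1 (c4 8 1 6 5)
  (split 8 4 1 (split 8 7 1 (c4 8 4 5 7) (c7 8 1 0 3 7 5 4)) (split 8 7 1 (c7 8 1 0 2 4 5 7) (p7 8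
  1 0 2 4 5 7)))))) (gd 0 1 8 9) (split 8 2 0 (c4 8 1 0 2) (split 8 3 0 (c4 8 1 0 3) (split 8 4 1
  (split 8 5 1 (gm 4 5 6 1 8) (c4 8 4 5 6)) (split 8 5 1 (split 9 5 1 (c4 9 1 8 5) (gm 9 1 8 5 6))
  (p7 8 6 5 4 2 0 3)))))))) (split 7 6 3 (split 7 2 0 (c4 7 2 0 3) (c7 7 3 0 2 4 5 6)) (split 7 1
  0 (c4 7 1 0 3) (p7 7 3 0 1 6 5 4)))))))) (step 7 (split 7 1 0 (c7 7 1 0 2 4 5 6) (p7 7 6 5 4 2 0
  1)))))))))))

module Claw
  (G : Graph) (Q : Set) (r : Graph.Vertex G)
  (C4⇒Q : HasInduced G (C 4) → Q) (gem⇒Q : HasInduced G gem → Q)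
  (P7⇒Q : HasInduced G (P 7) → Q) (C7⇒Q : HasInduced G (C 7) → Q)
  (petersen⇒Q : HasInduced G petersen → Q)
  where
  open Basics G
  open Walks G r

  Fork : Set
  Fork = ∀ {f a b} → Adj f a → Adj f b → Sep a b →
    (∀ x → Adj f x → Sep a x → Sep b x → Q) →
    (∀ x y → Adj f x → Adj a x → Sep b x → Adj f y → Adj a y → Sep b y → Sep x y → Q) →
    (∀ x y → Adj f x → Adj b x → Sep a x → Adj f y → Adj b y → Sep a y → Sep x y → Q) →
    Q

  Leaf : Vertex → Set
  Leaf v = Joined v × (∀ {x y} → Adj r x → Adj r y → Adj v x → Adj v y → ¬ Sep x y)

  Tag : ℕ → Vertex → Set
  Tag 0 v = v ≡ r
  Tag _ v = Leaf v

  open Engine G Q Tag Walk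

  module _ (fork-rule : Fork)
    (linked : ∀ {x y} → Away x → Away y → Star AwayStep x y)
    (spread : ∀ {x} → Away x → Joined x)
    where

    rules : Rules
    rules = record
      { fork-rule   = fork-rule
      ; Joined      = Joined
      ; far-joined  = λ { refl → spread }
      ; leaf-joined = proj₁
      ; begin-rule  = start linked
      ; step-rule   = λ { refl → advance }
      }

    roots : Facts
    roots = tag 0 0 ∷ tag 1 1 ∷ tag 1 2 ∷ tag 1 3 ∷ []

    -- This closes the outcome of a fork at a leaf in which `r` gains two independent neighbours in
    -- common with that leaf.
    good : Facts
    good = tag 0 0 ∷ tag 1 1 ∷ link true 0 2 ∷ link true 0 3 ∷ link true 1 2 ∷ link true 1 3
         ∷ link false 2 3 ∷ []

    good-settles : Settles good
    good-settles ρ (refl ∷ (_ , clique) ∷ ra ∷ rb ∷ va ∷ vb ∷ ab ∷ []) =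
      contradiction ab (clique ra rb va vb)

    basic : Known
    basic = (_ , settles-links {C 4} C4⇒Q) ∷ (_ , settles-links {gem} gem⇒Q)
          ∷ (_ , settles-links {P 7} P7⇒Q) ∷ (_ , settles-links {C 7} C7⇒Q)
          ∷ (_ , good-settles) ∷ (_ , settles-links {petersen} petersen⇒Q) ∷ []

    path-settles : Settles (roots ++ links claw-with-path)
    path-settles = Check.settle basic (just rules) path-tree _

    claw : Facts
    claw = roots ++ link true 0 1 ∷ link true 0 2 ∷ link true 0 3
                  ∷ link false 1 2 ∷ link false 1 3 ∷ link false 2 3 ∷ []

    claw-settles : Settles claw
    claw-settles = Check.settle (basic ++ (_ , path-settles) ∷ []) (just rules) claw-tree _

-- Vertices around a Petersen graph

edge : Fin 10 → Fin 10 → Bool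
edge i j = does (Graph.adj? petersen i j)

-- Closed neighbourhoods: in a blowup a twin is also adjacent to the vertex it copies.
star : Fin 10 → Fin 10 → Bool
star m k = does (m Fin.≟ k) ∨ edge m k

-- Automorphisms sending 0 to k: rotations for k < 5, otherwise composed with an
-- exchange of the two 5-cycles.
shift : Fin 10 → Fin 10 → Fin 10
shift k i = Vec.lookup (Vec.lookup table k) i
  where
  table : Vec (Vec (Fin 10) 10) 10
  table =
    (# 0 ∷ # 1 ∷ # 2 ∷ # 3 ∷ # 4 ∷ # 5 ∷ # 6 ∷ # 7 ∷ # 8 ∷ # 9 ∷ []) ∷
    (# 1 ∷ # 2 ∷ # 3 ∷ # 4 ∷ # 0 ∷ # 6 ∷ # 7 ∷ # 8 ∷ # 9 ∷ # 5 ∷ []) ∷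
    (# 2 ∷ # 3 ∷ # 4 ∷ # 0 ∷ # 1 ∷ # 7 ∷ # 8 ∷ # 9 ∷ # 5 ∷ # 6 ∷ []) ∷
    (# 3 ∷ # 4 ∷ # 0 ∷ # 1 ∷ # 2 ∷ # 8 ∷ # 9 ∷ # 5 ∷ # 6 ∷ # 7 ∷ []) ∷
    (# 4 ∷ # 0 ∷ # 1 ∷ # 2 ∷ # 3 ∷ # 9 ∷ # 5 ∷ # 6 ∷ # 7 ∷ # 8 ∷ []) ∷
    (# 5 ∷ # 7 ∷ # 9 ∷ # 6 ∷ # 8 ∷ # 0 ∷ # 2 ∷ # 4 ∷ # 1 ∷ # 3 ∷ []) ∷
    (# 6 ∷ # 8 ∷ # 5 ∷ # 7 ∷ # 9 ∷ # 1 ∷ # 3 ∷ # 0 ∷ # 2 ∷ # 4 ∷ []) ∷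
    (# 7 ∷ # 9 ∷ # 6 ∷ # 8 ∷ # 5 ∷ # 2 ∷ # 4 ∷ # 1 ∷ # 3 ∷ # 0 ∷ []) ∷
    (# 8 ∷ # 5 ∷ # 7 ∷ # 9 ∷ # 6 ∷ # 3 ∷ # 0 ∷ # 2 ∷ # 4 ∷ # 1 ∷ []) ∷
    (# 9 ∷ # 6 ∷ # 8 ∷ # 5 ∷ # 7 ∷ # 4 ∷ # 1 ∷ # 3 ∷ # 0 ∷ # 2 ∷ []) ∷ []

abstract
  shift-0 : ∀ k → shift k (# 0) ≡ k
  shift-0 = from-yes (all? λ k → shift k (# 0) Fin.≟ k)

  shift-edge : ∀ k i j → i ≢ j → shift k i ≢ shift k j × edge (shift k i) (shift k j) ≡ edge i j
  shift-edge = from-yes (all? λ k → all? λ i → all? λ j → ¬? (i Fin.≟ j) →-dec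
    (¬? (shift k i Fin.≟ shift k j) ×-dec (edge (shift k i) (shift k j) Bool.≟ edge i j)))

  edge-sym : ∀ i j → edge i j ≡ edge j i
  edge-sym = from-yes (all? λ i → all? λ j → edge i j Bool.≟ edge j i)

  -- Of the three independent neighbours of `m` at most one is `p`.
  star-spread : ∀ m p → ∃ λ i → ∃ λ j → i ≢ j × i ≢ p × j ≢ p ×
    star m i ≡ true × star m j ≡ true × edge i j ≡ false
  star-spread = from-yes (all? λ m → all? λ p → any? λ i → any? λ j →
    ¬? (i Fin.≟ j) ×-dec ¬? (i Fin.≟ p) ×-dec ¬? (j Fin.≟ p) ×-dec
    (star m i Bool.≟ true) ×-dec (star m j Bool.≟ true) ×-dec (edge i j Bool.≟ false))

  -- Closed neighbourhoods of distinct vertices differ in at least four places, so a single position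
  -- `p`, later the exchanged one, can be ignored.
  star-separates : ∀ p m q → m ≡ q ⊎ ∃ λ k → k ≢ p × star m k ≢ star q k
  star-separates = from-yes (all? λ p → all? λ m → all? λ q → (m Fin.≟ q) ⊎-dec
    any? λ k → ¬? (k Fin.≟ p) ×-dec ¬? (star m k Bool.≟ star q k))

  star-triangle-free : ∀ m → ∃ λ i → ∃ λ j → i ≢ j ×
    edge m i ≡ true × edge m j ≡ true × edge i j ≡ false × m ≢ i × m ≢ j
  star-triangle-free = from-yes (all? λ m → any? λ i → any? λ j → ¬? (i Fin.≟ j) ×-dec
    (edge m i Bool.≟ true) ×-dec (edge m j Bool.≟ true) ×-dec (edge i j Bool.≟ false) ×-dec
    ¬? (m Fin.≟ i) ×-dec ¬? (m Fin.≟ j))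

-- The complete list, as the Petersen graph has no triangle; `sy` refers to its order.
cliques : List (List (Fin 10))
cliques = [] ∷ map (_∷ []) (allFin 10) ++
    (# 0 ∷ # 1 ∷ []) ∷ (# 1 ∷ # 2 ∷ []) ∷ (# 2 ∷ # 3 ∷ []) ∷ (# 3 ∷ # 4 ∷ []) ∷ (# 4 ∷ # 0 ∷ []) ∷
    (# 5 ∷ # 7 ∷ []) ∷ (# 7 ∷ # 9 ∷ []) ∷ (# 9 ∷ # 6 ∷ []) ∷ (# 6 ∷ # 8 ∷ []) ∷ (# 8 ∷ # 5 ∷ []) ∷
    (# 0 ∷ # 5 ∷ []) ∷ (# 1 ∷ # 6 ∷ []) ∷ (# 2 ∷ # 7 ∷ []) ∷ (# 3 ∷ # 8 ∷ []) ∷ (# 4 ∷ # 9 ∷ []) ∷ []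

member : List (Fin 10) → Fin 10 → Bool
member ks k = does (Any.any? (k Fin.≟_) ks)

abstract
  members-linked : All (λ ks → ∀ i j → i ≢ j → member ks i ≡ true → member ks j ≡ true →
                                edge i j ≡ true) cliques
  members-linked = from-yes (All.all? (λ ks → all? λ i → all? λ j → ¬? (i Fin.≟ j) →-dec
    (member ks i Bool.≟ true) →-dec (member ks j Bool.≟ true) →-dec
    (edge i j Bool.≟ true)) cliques)

-- Twins of the m-th vertex and strays adjacent to the c-th clique.
tw sy : ℕ → Tree
tw m   = cite (4 + m) (upTo 11)
sy c   = cite (14 + c) (upTo 11)

-- Vertices 0 to 9 are the Petersen graph, 10 and 11 the vertices around it.
-- Found by computer search.
classify-tree two-strays-tree : Tree
classify-tree =
  split 10 0 0 (split 10 2 0 (split 10 1 0 (split 10 3 0 (gm 0 1 2 3 10) (split 10 4 0 (c4 10 2 3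
  4) (split 10 5 0 (gm 5 0 1 2 10) (split 10 7 0 (c4 10 0 5 7) (split 10 8 0 (c4 10 0 5 8) (split
  10 9 0 (c4 10 0 4 9) (split 10 6 0 (tw 1) (p7 0 10 2 3 8 6 9)))))))) (c4 10 0 1 2)) (split 10 6
  0 (split 10 1 0 (split 10 3 0 (c4 10 1 2 3) (split 10 4 0 (gm 4 0 1 6 10) (split 10 7 0 (c4 10 1
  2 7) (p7 6 10 0 4 3 2 7)))) (c4 10 0 1 6)) (split 10 3 0 (split 10 4 0 (split 10 1 0 (c4 10 1 2
  3) (split 10 5 0 (gm 5 0 4 3 10) (split 10 7 0 (c4 10 0 5 7) (split 10 9 0 (split 10 8 0 (c4 10
  0 5 8) (tw 4)) (p7 0 10 3 2 7 9 6))))) (c4 10 0 4 3)) (split 10 9 0 (split 10 8 0 (c4 10 8 6 9)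
  (p7 0 10 9 6 8 3 2)) (split 10 7 0 (split 10 8 0 (split 10 5 0 (split 10 1 0 (c4 10 1 2 7)
  (split 10 4 0 (c4 10 4 9 7) (tw 5))) (c4 10 0 5 7)) (p7 0 10 7 2 3 8 6)) (split 10 8 0 (p7 0 10
  8 3 2 7 9) (split 10 1 0 (split 10 4 0 (split 10 5 0 (tw 0) (p7 1 10 4 3 8 5 7)) (split 10 5 0
  (p7 1 10 5 7 9 4 3) (sy 11))) (split 10 4 0 (split 10 5 0 (p7 4 10 5 7 2 1 6) (sy 15)) (split 10
  5 0 (sy 21) (sy 1)))))))))) (split 10 1 0 (split 10 4 0 (c4 10 1 0 4) (split 10 5 0 (c4 10 1 0
  5) (split 10 3 0 (split 10 2 0 (split 10 6 0 (gm 6 1 2 3 10) (split 10 8 0 (c4 10 1 6 8) (split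
  10 9 0 (c4 10 1 6 9) (split 10 7 0 (tw 2) (p7 1 10 3 4 9 7 5))))) (c4 10 1 2 3)) (split 10 7 0
  (split 10 8 0 (c4 10 7 5 8) (p7 1 10 7 5 8 3 4)) (split 10 8 0 (split 10 9 0 (split 10 6 0
  (split 10 2 0 (c4 10 2 3 8) (tw 6)) (c4 10 1 6 8)) (p7 1 10 8 3 4 9 7)) (split 10 9 0 (p7 1 10 9
  4 3 8 5) (split 10 2 0 (split 10 6 0 (p7 2 10 6 8 5 0 4) (sy 12)) (split 10 6 0 (sy 22) (sy
  2))))))))) (split 10 2 0 (split 10 6 0 (c4 10 2 1 6) (split 10 4 0 (split 10 3 0 (split 10 5 0
  (c4 10 4 0 5) (split 10 8 0 (split 10 7 0 (c4 10 7 5 8) (split 10 9 0 (c4 10 2 7 9) (tw 3))) (p7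
  2 10 4 0 5 8 6))) (c4 10 2 3 4)) (split 10 8 0 (split 10 9 0 (c4 10 8 6 9) (p7 2 10 8 6 9 4 0))
  (split 10 5 0 (split 10 9 0 (split 10 7 0 (split 10 3 0 (c4 10 3 8 5) (tw 7)) (c4 10 2 7 5)) (p7
  2 10 5 0 4 9 6)) (split 10 9 0 (p7 2 10 9 4 0 5 8) (split 10 3 0 (split 10 7 0 (p7 3 10 7 5 0 1
  6) (sy 13)) (split 10 7 0 (sy 23) (sy 3)))))))) (split 10 3 0 (split 10 7 0 (c4 10 3 2 7) (split
  10 9 0 (split 10 5 0 (c4 10 5 7 9) (p7 3 10 9 7 5 0 1)) (split 10 5 0 (split 10 8 0 (split 10 6
  0 (split 10 4 0 (c4 10 4 0 5) (tw 8)) (p7 3 10 5 0 1 6 9)) (c4 10 3 8 5)) (split 10 6 0 (p7 3 10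
  6 1 0 5 7) (split 10 4 0 (split 10 8 0 (p7 4 10 8 5 7 2 1) (sy 14)) (split 10 8 0 (sy 24) (sy
  4))))))) (split 10 5 0 (split 10 4 0 (c4 10 4 0 5) (split 10 6 0 (p7 5 10 6 1 2 3 4) (split 10 9
  0 (p7 5 10 9 4 3 2 1) (split 10 7 0 (split 10 8 0 (p7 7 10 8 3 4 0 1) (sy 16)) (split 10 8 0 (sy
  20) (sy 6)))))) (split 10 8 0 (split 10 4 0 (c4 10 4 3 8) (split 10 7 0 (c4 10 7 5 8) (split 10
  9 0 (p7 8 10 9 4 0 1 2) (split 10 6 0 (sy 19) (sy 9))))) (split 10 4 0 (split 10 6 0 (split 10 9
  0 (split 10 7 0 (tw 9) (p7 4 10 6 1 2 7 5)) (c4 10 4 9 6)) (split 10 7 0 (p7 4 10 7 2 1 6 8)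
  (split 10 9 0 (sy 25) (sy 5)))) (split 10 6 0 (split 10 7 0 (p7 6 10 7 2 3 4 0) (split 10 9 0
  (sy 18) (sy 7))) (split 10 7 0 (split 10 9 0 (sy 17) (sy 8)) (split 10 9 0 (sy 10) (sy
  0))))))))))
two-strays-tree =
  split 10 2 0 (split 10 1 0 (split 10 3 0 (gm 0 1 2 3 10) (split 10 4 0 (c4 10 2 3 4) (split 10 5
  0 (gm 5 0 1 2 10) (split 10 7 0 (c4 10 0 5 7) (split 10 8 0 (c4 10 0 5 8) (split 10 9 0 (c4 10 0
  4 9) (split 10 6 0 (tw 1) (p7 0 10 2 3 8 6 9)))))))) (c4 10 0 1 2)) (split 10 6 0 (split 10 1 0
  (split 10 3 0 (c4 10 1 2 3) (split 10 4 0 (gm 4 0 1 6 10) (split 10 7 0 (c4 10 1 2 7) (p7 6 10 0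
  4 3 2 7)))) (c4 10 0 1 6)) (split 10 3 0 (split 10 4 0 (split 10 1 0 (c4 10 1 2 3) (split 10 5 0
  (gm 5 0 4 3 10) (split 10 7 0 (c4 10 0 5 7) (split 10 9 0 (split 10 8 0 (c4 10 0 5 8) (tw 4))
  (p7 0 10 3 2 7 9 6))))) (c4 10 0 4 3)) (split 10 9 0 (split 10 8 0 (c4 10 8 6 9) (p7 0 10 9 6 8
  3 2)) (split 10 7 0 (split 10 8 0 (split 10 5 0 (split 10 1 0 (c4 10 1 2 7) (split 10 4 0 (c4 10
  4 9 7) (tw 5))) (c4 10 0 5 7)) (p7 0 10 7 2 3 8 6)) (split 10 8 0 (p7 0 10 8 3 2 7 9) (split 10
  1 0 (split 10 4 0 (split 10 5 0 (tw 0) (p7 1 10 4 3 8 5 7)) (split 10 5 0 (p7 1 10 5 7 9 4 3)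
  (split 11 4 0 (c4 11 4 0 10) (split 11 5 0 (c4 11 5 0 10) (split 11 1 0 (split 11 2 0 (gm 0 10
  11 2 1) (split 11 3 0 (c4 11 1 2 3) (split 11 7 0 (c4 11 1 2 7) (p7 11 10 0 4 3 2 7)))) (split
  11 2 0 (c4 11 2 1 10) (split 11 3 0 (split 11 7 0 (c4 11 3 2 7) (c7 11 3 2 7 5 0 10)) (split 11
  7 0 (c7 11 7 2 3 4 0 10) (p7 11 10 0 4 3 2 7))))))))) (split 10 4 0 (split 11 1 0 (c4 11 1 0 10)
  (split 11 4 0 (split 11 3 0 (gm 0 10 11 3 4) (split 11 2 0 (c4 11 2 3 4) (split 11 8 0 (c4 11 4
  3 8) (p7 11 10 0 1 2 3 8)))) (split 11 3 0 (c4 11 3 4 10) (split 11 9 0 (c4 11 9 4 10) (split 11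
  2 0 (split 11 6 0 (c4 11 2 1 6) (c7 11 2 1 6 9 4 10)) (split 11 6 0 (c7 11 6 1 2 3 4 10) (p7 11
  10 4 3 2 1 6))))))) (split 10 5 0 (split 11 1 0 (c4 11 1 0 10) (split 11 5 0 (split 11 7 0 (gm 0
  10 11 7 5) (split 11 2 0 (c4 11 2 7 5) (split 11 9 0 (c4 11 5 7 9) (p7 11 10 0 1 2 7 9))))
  (split 11 7 0 (c4 11 7 5 10) (split 11 8 0 (c4 11 8 5 10) (split 11 2 0 (split 11 6 0 (c4 11 2 1
  6) (c7 11 2 1 6 8 5 10)) (split 11 6 0 (c7 11 6 1 2 7 5 10) (p7 11 10 5 7 2 1 6))))))) (split 11
  1 0 (c4 11 1 0 10) (split 11 4 0 (c4 11 4 0 10) (split 11 5 0 (c4 11 5 0 10) (split 11 2 0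
  (split 11 6 0 (c4 11 2 1 6) (split 11 9 0 (split 11 8 0 (c4 11 8 6 9) (c7 11 9 6 8 5 0 10)) (p7
  2 11 10 0 4 9 6))) (split 11 3 0 (split 11 7 0 (c4 11 3 2 7) (c7 11 3 2 7 5 0 10)) (split 11 7 0
  (c7 11 7 2 3 4 0 10) (p7 11 10 0 4 3 2 7)))))))))))))))

module Petersen
  (G : Graph)
  (¬C4 : ¬ HasInduced G (C 4)) (¬gem : ¬ HasInduced G gem)
  (¬P7 : ¬ HasInduced G (P 7)) (¬C7 : ¬ HasInduced G (C 7))
  where
  open Basics G

  Frame : Set
  Frame = Fin 10 → Vertex

  HasRow : Frame → Vertex → (Fin 10 → Bool) → Set
  HasRow f x b = ∀ k → Link (b k) x (f k)

  Twin : Frame → Vertex → Fin 10 → Set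
  Twin f x m = x ≡ f m ⊎ HasRow f x (star m)

  record Stray (f : Frame) (x : Vertex) : Set where
    field
      outside : ∀ k → x ≢ f k
      linked  : ∀ i j → i ≢ j → Adj x (f i) → Adj x (f j) → edge i j ≡ true

  module Names (f : Frame) (x y : Vertex) where
    ρ₀ : Env G
    ρ₀ n with n <? 10
    ... | yes n<10 = f (Fin.fromℕ< n<10)
    ... | no  _ with n
    ...   | 11 = y
    -- Name 10 stands for `x`, and so does every name above 11.
    ...   | _  = x

    ρ₀-toℕ : ∀ k → ρ₀ (toℕ k) ≡ f k
    ρ₀-toℕ k with toℕ k <? 10
    ... | yes k<10 = cong f (fromℕ<-toℕ k k<10)
    ... | no  k≮10 = contradiction (toℕ<n k) k≮10

    -- A settled configuration must hold for all environments, while a row concerns this frame and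
    -- this `x`; the tags tie names to these vertices.
    Tag : ℕ → Vertex → Set
    Tag k v = v ≡ ρ₀ k

    module E (Q : Set) = Engine G Q Tag (λ _ _ _ → ⊥)

    frameTags tags : Facts
    frameTags = map (λ k → tag k k) (upTo 10)
    tags = map (λ k → tag k k) (upTo 12)

    rowFacts : (Fin 10 → Bool) → Facts
    rowFacts b = tabulate λ k → link (b k) 10 (toℕ k)

    module _ {Q : Set} where
      open E Q

      settles-row : ∀ b → (HasRow f x b → Q) → Settles (tag 10 10 ∷ frameTags ++ rowFacts b)
      settles-row b q ρ (t₁₀ ∷ hs) = q λ k → subst₂ (Link (b k)) t₁₀ (trans (at-k k) (ρ₀-toℕ k))
        (Allₚ.tabulate⁻ {f = λ k → link (b k) 10 (toℕ k)} (Allₚ.++⁻ʳ frameTags hs) k)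
        where
        at-k : ∀ (k : Fin 10) → ρ (toℕ k) ≡ ρ₀ (toℕ k)
        at-k k = All.lookup (Allₚ.map⁻ {f = λ k → tag k k} (Allₚ.++⁻ˡ frameTags hs))
                            (∈-upTo⁺ (toℕ<n k))

      closed : Known
      closed = (_ , settles-links {C 4} (⊥-elim ∘ ¬C4)) ∷ (_ , settles-links {gem} (⊥-elim ∘ ¬gem))
             ∷ (_ , settles-links {P 7} (⊥-elim ∘ ¬P7)) ∷ (_ , settles-links {C 7} (⊥-elim ∘ ¬C7)) ∷ []

      twins : (∀ m → HasRow f x (star m) → Q) → Known
      twins q = map (λ m → _ , settles-row (star m) (q m)) (allFin 10)

      strays : ∀ kss → All (λ ks → HasRow f x (member ks) → Q) kss → Known
      strays []         _  = []
      strays (ks ∷ kss) qs = (_ , settles-row (member ks) (All.head qs)) ∷ strays kss (All.tail qs)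

      holds-links : Induces petersen f → All (Holds ρ₀) (links petersen)
      holds-links ind = Allₚ.map⁺ {f = λ (i , j) → link (edge i j) (toℕ i) (toℕ j)}
        (All.map (λ {(i , j)} i<j →
        subst₂ (Link (edge i j)) (sym (ρ₀-toℕ i)) (sym (ρ₀-toℕ j)) (ind i j (<⇒≢ i<j)))
        (Allₚ.all-filter (λ (i , j) → i Fin.<? j) (cartesianProduct (allFin 10) (allFin 10))))

      holds-tags : All (Holds ρ₀) tags
      holds-tags = Allₚ.map⁺ {f = λ k → tag k k} (All.universal (λ _ → refl) (upTo 12))

  classify : ∀ {f} → Induces petersen f → ∀ x → (∃ (Twin f x)) ⊎ Stray f x
  classify {f} ind x with any? (λ k → x Fin.≟ f k)
  ... | yes (k , x≡fk) = inj₁ (k , inj₁ x≡fk)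
  ... | no  x∉f        = settle classify-tree (tags ++ neqs ++ links petersen) ρ₀
    (Allₚ.++⁺ (holds-tags {Goal}) (Allₚ.++⁺ holds-neqs (holds-links {Goal} ind)))
    where
    open Names f x x
    Goal : Set
    Goal = (∃ (Twin f x)) ⊎ Stray f x
    open E Goal
    known : Known
    known = closed ++ twins (λ m r → inj₁ (m , inj₂ r)) ++ strays cliques (All.map
      (λ linked r → inj₂ (record
        { outside = λ k x≡fk → x∉f (k , x≡fk)
        ; linked  = λ i j i≢j xi xj →
            linked i j i≢j (Link-unique (r i) xi) (Link-unique (r j) xj)
        }))
      members-linked)
    open Check known nothing
    neqs : Facts
    neqs = tabulate {n = 10} λ k → neq 10 (toℕ k)
    holds-neqs : All (Holds ρ₀) neqs
    holds-neqs = Allₚ.tabulate⁺ {f = λ k → neq 10 (toℕ k)} λ k →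
      subst (x ≢_) (sym (ρ₀-toℕ k)) λ x≡fk → x∉f (k , x≡fk)

  HasRow-adj : ∀ {f x k} b → HasRow f x b → b k ≡ true → Adj x (f k)
  HasRow-adj {f} {x} {k} b r bk = subst (λ c → Link c x (f k)) bk (r k)

  -- Even with position `p` hidden, `x` would see two independent vertices of the frame. The hidden
  -- position is the one that `swap` changes.
  Stray-row : ∀ {f x} m p → Stray f x → ¬ (∀ k → k ≢ p → Link (star m k) x (f k))
  Stray-row {f} {x} m p s r with star-spread m p
  ... | i , j , i≢j , i≢p , j≢p , mi , mj , ¬ij =
    contradiction (trans (sym ¬ij) (Stray.linked s i j i≢j (adj i i≢p mi) (adj j j≢p mj))) λ ()
    where
    adj : ∀ k → k ≢ p → star m k ≡ true → Adj x (f k)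
    adj k k≢p mk = subst (λ c → Link c x (f k)) mk (r k k≢p)

  Stray⇒¬Twin : ∀ {f x m} → Stray f x → ¬ Twin f x m
  Stray⇒¬Twin {m = m} s (inj₁ x≡fm) = Stray.outside s m x≡fm
  Stray⇒¬Twin {m = m} s (inj₂ r)    = Stray-row m m s (λ k _ → r k)

  -- An automorphism moves `k` to 0, so one tree covers all ten positions. Its branches end in a
  -- forbidden subgraph or make `x` a twin, which a stray is not.
  strays-agree : ∀ {f x y k} → Induces petersen f → Stray f x → Stray f y → Adj x y →
    Adj x (f k) → Adj y (f k)
  strays-agree {f} {x} {y} {k} ind s t xy xk with compare y (f k)
  ... | same y≡fk = contradiction y≡fk (Stray.outside t k)
  ... | near yk   = yk
  ... | far  ¬yk  = ⊥-elim (settle two-strays-tree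
      (tags ++ link true 10 11 ∷ link true 10 0 ∷ link false 11 0
            ∷ neqs 10 ++ neqs 11 ++ links petersen) ρ₀
      (Allₚ.++⁺ (holds-tags {⊥}) (xy ∷ at-0 true xk ∷ at-0 false ¬yk ∷
        Allₚ.++⁺ (Allₚ.tabulate⁺ {f = λ i → neq 10 (toℕ i)} (away s))
          (Allₚ.++⁺ (Allₚ.tabulate⁺ {f = λ i → neq 11 (toℕ i)} (away t)) (holds-links {⊥} shifted)))))
    where
    g : Frame
    g = f ∘ shift k
    open Names g x y
    open E ⊥
    shifted : Induces petersen g
    shifted i j i≢j with shift-edge k i j i≢j
    ... | si≢sj , e = subst (λ b → Link b (g i) (g j)) e (ind _ _ si≢sj)
    at-0 : ∀ b {u} → Link b u (f k) → Link b u (g (# 0))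
    at-0 b {u} = subst (λ i → Link b u (f i)) (sym (shift-0 k))
    not-twin : ∀ {u} → Stray f u → ∀ m → ¬ HasRow g u (star m)
    not-twin s m r with star-spread m m
    ... | i , j , i≢j , _ , _ , mi , mj , ¬ij with shift-edge k i j i≢j
    ...   | si≢sj , e = contradiction
      (trans (sym (trans e ¬ij)) (Stray.linked s _ _ si≢sj
        (HasRow-adj {g} (star m) r mi) (HasRow-adj {g} (star m) r mj))) λ ()
    away : ∀ {u} → Stray f u → ∀ i → u ≢ ρ₀ (toℕ i)
    away s i = subst (_ ≢_) (sym (ρ₀-toℕ i)) (Stray.outside s (shift k i))
    neqs : ℕ → Facts
    neqs n = tabulate {n = 10} λ i → neq n (toℕ i)
    open Check (closed ++ twins (λ m r → not-twin s m r)) nothing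

  -- Exchanging a vertex of a Petersen graph for a twin

  swap : Frame → Fin 10 → Vertex → Frame
  swap f p x k with k Fin.≟ p
  ... | yes _ = x
  ... | no  _ = f k

  swap-at : ∀ f p x → swap f p x p ≡ x
  swap-at f p x with p Fin.≟ p
  ... | yes _   = refl
  ... | no  p≢p = contradiction refl p≢p

  swap-off : ∀ f {p} x {k} → k ≢ p → swap f p x k ≡ f k
  swap-off f {p} x {k} k≢p with k Fin.≟ p
  ... | yes k≡p = contradiction k≡p k≢p
  ... | no  _   = refl

  star-off : ∀ {m k} → m ≢ k → star m k ≡ edge m k
  star-off {m} {k} m≢k with m Fin.≟ k
  ... | yes m≡k = contradiction m≡k m≢k
  ... | no  _   = refl

  Twin-off : ∀ {f x m k} → Induces petersen f → Twin f x m → m ≢ k → Link (edge m k) x (f k)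
  Twin-off {m = m} {k} ind (inj₁ refl) m≢k = ind m k m≢k
  Twin-off {f} {x} {m} {k} ind (inj₂ r) m≢k = subst (λ b → Link b x (f k)) (star-off {m} {k} m≢k) (r k)

  swap-induces : ∀ {f p x} → Induces petersen f → Twin f x p → Induces petersen (swap f p x)
  swap-induces {f} {p} {x} ind tw i j i≢j with i Fin.≟ p | j Fin.≟ p
  ... | yes refl | yes refl = contradiction refl i≢j
  ... | yes refl | no  j≢p  = Twin-off ind tw i≢j
  ... | no  _    | no  _    = ind i j i≢j
  ... | no  i≢p  | yes refl = subst (λ b → Link b (f i) x) (edge-sym p i)
    (Link-sym (edge p i) (Twin-off ind tw (i≢p ∘ sym)))

  row-off : ∀ {f p x y b} → HasRow (swap f p x) y b → ∀ k → k ≢ p → Link (b k) y (f k)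
  row-off {f} {p} {x} {y} {b} r k k≢p = subst (Link (b k) y) (swap-off f x k≢p) (r k)

  -- Off `p` the row of `y` is unchanged, which rules out that `y` becomes a stray or a twin of
  -- another vertex. Classifying `y` in the new frame thus decides the one unknown link, that to
  -- `x`.
  swap-Twin : ∀ {f p q x y} → Induces petersen f → Twin f x p → Twin f y q → p ≢ q →
    Twin (swap f p x) y q
  swap-Twin {f} {p} {q} {x} {y} ind tx (inj₁ refl) p≢q = inj₁ (sym (swap-off f x (p≢q ∘ sym)))
  swap-Twin {f} {p} {q} {x} {y} ind tx (inj₂ r) p≢q with classify (swap-induces ind tx) y
  ... | inj₂ s = ⊥-elim (Stray-row q p s λ k k≢p →
    subst (Link (star q k) y) (sym (swap-off f x k≢p)) (r k))
  ... | inj₁ (m , inj₂ r′) with star-separates p m q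
  ...   | inj₁ refl            = inj₂ r′
  ...   | inj₂ (k , k≢p , m≢q) = contradiction
    (Link-unique {star m k} (row-off {f} {p} {x} {b = star m} r′ k k≢p) (r k)) m≢q
  swap-Twin {f} {p} {q} {x} {y} ind tx (inj₂ r) p≢q | inj₁ (m , inj₁ y≡) with m Fin.≟ p
  ...   | no  m≢p  = contradiction y≡ (Link⇒≢ (star q m) (r m))
  ...   | yes refl with tx | star-separates p p q
  ...     | inj₁ x≡fp | _                        = contradiction (trans y≡ x≡fp) (Link⇒≢ (star q p) (r p))
  ...     | inj₂ _    | inj₁ p≡q                 = contradiction p≡q p≢q
  ...     | inj₂ r″   | inj₂ (k , k≢p , pk≢qk) = contradiction
    (Link-unique {star p k} (r″ k) (subst (λ v → Link (star q k) v (f k)) y≡ (r k))) pk≢qk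

  -- Once `x` takes position `p`, the row of `y` at `p` speaks of `x`.
  Twins-linked : ∀ {f p q x y} → Induces petersen f → Twin f x p → Twin f y q → p ≢ q →
    Link (edge p q) x y
  Twins-linked {f} {p} {q} {x} {y} ind tx ty p≢q =
    subst (λ b → Link b x y) (edge-sym q p) (Link-sym (edge q p)
      (subst (Link (edge q p) y) (swap-at f p x)
      (Twin-off (swap-induces ind tx) (swap-Twin ind tx ty p≢q) (p≢q ∘ sym))))

  -- Otherwise `x` would be linked to itself.
  Twin-unique : ∀ {f p q x} → Induces petersen f → Twin f x p → Twin f x q → p ≡ q
  Twin-unique {p = p} {q} ind tx ty with p Fin.≟ q
  ... | yes p≡q = p≡q
  ... | no  p≢q = contradiction refl (Link⇒≢ (edge p q) (Twins-linked ind tx ty p≢q))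

  open Forbidden G ¬C4 ¬gem

  -- Independent twins of `p` and two independent neighbours of `p` would form a `C 4`.
  Twins-clique : ∀ {f p x y} → Induces petersen f → Twin f x p → Twin f y p → x ≢ y → Adj x y
  Twins-clique {f} {p} {x} {y} ind tx ty x≢y with adj? x y | star-triangle-free p
  ... | yes xy | _ = xy
  ... | no ¬xy | i , j , i≢j , pi , pj , ¬ij , p≢i , p≢j = ⊥-elim
    (no-C4 (at tx p≢i pi) (adj-sym (at ty p≢i pi)) (at ty p≢j pj) (adj-sym (at tx p≢j pj)) (x≢y , ¬xy)
           (subst (λ b → Link b (f i) (f j)) ¬ij (ind i j i≢j)))
    where
    at : ∀ {u k} → Twin f u p → p ≢ k → edge p k ≡ true → Adj u (f k)
    at {u} {k} tu p≢k pk = subst (λ b → Link b u (f k)) pk (Twin-off ind tu p≢k)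

  swap-Stray : ∀ {f p x y} → Induces petersen f → Twin f x p → Stray f y → Stray (swap f p x) y
  swap-Stray {f} {p} {x} ind tx s with classify (swap-induces ind tx) _
  ... | inj₂ s′            = s′
  ... | inj₁ (m , inj₂ r) = ⊥-elim (Stray-row m p s (row-off {f} {p} {x} {b = star m} r))
  ... | inj₁ (m , inj₁ y≡) with m Fin.≟ p
  ...   | yes refl = ⊥-elim (Stray⇒¬Twin s (subst (λ v → Twin f v p) (sym y≡) tx))
  ...   | no  _    = ⊥-elim (Stray⇒¬Twin {m = m} s (inj₁ y≡))

  adjacent-strays : ∀ {f p x y b} → Induces petersen f → Stray f x → Stray f y → Adj x y →
    Twin f b p → Adj x b → Adj y b
  adjacent-strays {f} {p} {b = b} ind s t xy tb xb = subst (Adj _) (swap-at f p b)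
    (strays-agree {k = p} (swap-induces ind tb) (swap-Stray ind tb s) (swap-Stray ind tb t) xy
      (subst (Adj _) (sym (swap-at f p b)) xb))

  -- For `p ≢ q` both `a` and `b` are put into one frame, in which `x` is still a stray.
  Stray-clique : ∀ {f x p q a b} → Induces petersen f → Stray f x → Twin f a p → Twin f b q →
    Adj x a → Adj x b → a ≢ b → Adj a b
  Stray-clique {f} {x} {p} {q} {a} {b} ind s ta tb xa xb a≢b with p Fin.≟ q
  ... | yes refl = Twins-clique ind ta tb a≢b
  ... | no  p≢q  = subst (λ c → Link c a b)
    (Stray.linked s″ p q p≢q (subst (Adj x) (sym (trans (swap-off f′ b p≢q) (swap-at f p a))) xa)
                             (subst (Adj x) (sym (swap-at f′ q b)) xb))
    (Twins-linked ind ta tb p≢q)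
    where
    f′ = swap f p a
    tb′ = swap-Twin ind ta tb p≢q
    s″ = swap-Stray (swap-induces ind ta) tb′ (swap-Stray ind ta s)

  -- Blowup or clique-cutset

  Boundary : Frame → Vertex → Set
  Boundary f x = ∃ (Twin f x)

  module _ (f : Frame) (ind : Induces petersen f) where

    twin? : ∀ m → Decidable (λ x → Twin f x m)
    twin? m x with classify ind x
    ... | inj₂ s = no (Stray⇒¬Twin s)
    ... | inj₁ (k , t) with k Fin.≟ m
    ...   | yes refl = yes t
    ...   | no  k≢m  = no (k≢m ∘ Twin-unique ind t)

    boundary? : Decidable (Boundary f)
    boundary? x with classify ind x
    ... | inj₁ t = yes t
    ... | inj₂ s = no (Stray⇒¬Twin s ∘ proj₂)

    stray? : Decidable (Stray f)
    stray? x with classify ind x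
    ... | inj₁ (_ , t) = no λ s → Stray⇒¬Twin s t
    ... | inj₂ s       = yes s

    blowup : ¬ ∃ (Stray f) → IsBlowupOf G petersen
    blowup no-stray = (λ m → ⟦ twin? m ⟧) , unique ,
      (λ m x∈ y∈ → Twins-clique ind (∈⟦⟧⁻ (twin? m) x∈) (∈⟦⟧⁻ (twin? m) y∈)) ,
      (λ {i} {j} ij x∈ y∈ → subst (λ b → Link b _ _) (dec-true (Graph.adj? petersen i j) ij)
        (linked (λ i≡j → Graph.adj-irrefl petersen i≡j ij) x∈ y∈)) ,
      (λ {i} {j} i≢j ¬ij x∈ y∈ → proj₂ (subst (λ b → Link b _ _) (dec-false (Graph.adj? petersen i j) ¬ij)
        (linked i≢j x∈ y∈)))
      where
      unique : ∀ x → ∃! _≡_ (λ m → x ∈ ⟦ twin? m ⟧)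
      unique x with classify ind x
      ... | inj₁ (m , t) = m , ∈⟦⟧⁺ (twin? m) t , λ {k} x∈ → Twin-unique ind t (∈⟦⟧⁻ (twin? k) x∈)
      ... | inj₂ s       = contradiction (x , s) no-stray
      linked : ∀ {i j x y} → i ≢ j → x ∈ ⟦ twin? i ⟧ → y ∈ ⟦ twin? j ⟧ → Link (edge i j) x y
      linked {i} {j} i≢j x∈ y∈ = Twins-linked ind (∈⟦⟧⁻ (twin? i) x∈) (∈⟦⟧⁻ (twin? j) y∈) i≢j

    -- Adjacent strays have the same neighbours among the twins of the frame,
    -- so those neighbours of one stray cut its component off.
    stray-cutset : Connected G → ∃ (Stray f) → HasCliqueCutset G
    stray-cutset conn (x , s) = cut
      where
      open Components G
      attached? : Decidable (λ b → Adj x b × Boundary f b)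
      attached? b = adj? x b ×-dec boundary? b
      K = ⟦ attached? ⟧
      -- This set contains the component of `x` among the strays and may be larger; closure is all
      -- that the cutset argument asks of it.
      like? : Decidable (λ y → Stray f y × ∀ b → Boundary f b → Adj y b → Adj x b)
      like? y = stray? y ×-dec all? λ b → boundary? b →-dec adj? y b →-dec adj? x b
      D = ⟦ like? ⟧
      clique : IsClique G K
      clique a∈ b∈ a≢b with ∈⟦⟧⁻ attached? a∈ | ∈⟦⟧⁻ attached? b∈
      ... | xa , _ , ta | xb , _ , tb = Stray-clique ind s ta tb xa xb a≢b
      closed : Closed (∁ K) D
      closed {y} {z} y∈ z∈ yz with ∈⟦⟧⁻ like? y∈ | classify ind z
      ... | t , y⇒x | inj₁ tz = contradiction (∈⟦⟧⁺ attached? (y⇒x z tz yz , tz)) (x∈∁p⇒x∉p z∈)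
      ... | t , y⇒x | inj₂ u  = ∈⟦⟧⁺ like? (u , λ b tb zb →
        y⇒x b tb (adjacent-strays ind u t (adj-sym yz) (proj₂ tb) zb))
      frame∉D : ∀ k → f k ∉ D
      frame∉D k fk∈ = Stray.outside (proj₁ (∈⟦⟧⁻ like? fk∈)) k refl
      cutset : ∀ k → f k ∉ K → HasCliqueCutset G
      cutset k fk∉K = clique-cutset conn clique (∈⟦⟧⁺ like? (s , λ _ _ xb → xb))
        (λ x∈ → Stray⇒¬Twin s (proj₂ (proj₂ (∈⟦⟧⁻ attached? x∈)))) (frame∉D k) fk∉K closed
      cut : HasCliqueCutset G
      -- Positions 0 and 2 are independent, so the clique `K` misses one of them, which then lies on
      -- the far side of the cut.
      cut with f (# 0) ∈? K | f (# 2) ∈? K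
      ... | no 0∉K | _      = cutset (# 0) 0∉K
      ... | _      | no 2∉K = cutset (# 2) 2∉K
      ... | yes 0∈K | yes 2∈K = contradiction (clique 0∈K 2∈K (proj₁ 0-2)) (proj₂ 0-2)
        where
        0-2 : Sep (f (# 0)) (f (# 2))
        0-2 = ind (# 0) (# 2) λ ()

  petersen⇒cutset-or-blowup : Connected G → HasInduced G petersen → HasCliqueCutset G ⊎ IsBlowupOf G petersen
  petersen⇒cutset-or-blowup conn h = decide (any? (stray? f ind))
    where
    f : Frame
    f = proj₁ h
    ind : Induces petersen f
    ind = HasInduced⇒Induces {petersen} h
    decide : Dec (∃ (Stray f)) → HasCliqueCutset G ⊎ IsBlowupOf G petersen
    decide (yes stray) = inj₁ (stray-cutset f ind conn stray)
    decide (no  none)  = inj₂ (blowup f ind none)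

-- Bisimplicial vertices and saturated regions

module Bisimpliciality
  (G : Graph) (¬C4 : ¬ HasInduced G (C 4)) (¬gem : ¬ HasInduced G gem)
  where
  open Basics G
  open Forbidden G ¬C4 ¬gem

  sep? : ∀ u v → Dec (Sep u v)
  sep? u v = ¬? (u Fin.≟ v) ×-dec ¬? (adj? u v)

  simplicial : ∀ {v} → (∀ {x y} → Adj v x → Adj v y → x ≢ y → Adj x y) → Bisimplicial G v
  simplicial {v} clique = N , N , N-clique , N-clique , λ u →
    mk⇔ (λ vu → x∈p∪q⁺ (inj₁ (∈⟦⟧⁺ (adj? v) vu)))
        (λ u∈ → Sum.[ ∈⟦⟧⁻ (adj? v) , ∈⟦⟧⁻ (adj? v) ] (x∈p∪q⁻ N N u∈))
    where
    N = ⟦ adj? v ⟧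
    N-clique : IsClique G N
    N-clique x∈ y∈ = clique (∈⟦⟧⁻ (adj? v) x∈) (∈⟦⟧⁻ (adj? v) y∈)

  ¬Sep⇒Adj : ∀ {x y} → x ≢ y → ¬ Sep x y → Adj x y
  ¬Sep⇒Adj {x} {y} x≢y ¬s with compare x y
  ... | same x≡y = contradiction x≡y x≢y
  ... | near xy  = xy
  ... | far  s   = contradiction s ¬s

  Single : Vertex → Vertex → Vertex → Vertex → Set
  Single f a b x = Adj f x × Sep a x × Sep b x

  Pair : Vertex → Vertex → Vertex → Vertex → Vertex → Set
  Pair f a b x y = Adj f x × Adj a x × Sep b x × Adj f y × Adj a y × Sep b y × Sep x y

  pair? : ∀ f a b → Dec (∃ λ x → ∃ λ y → Pair f a b x y)
  pair? f a b = any? λ x → any? λ y → adj? f x ×-dec adj? a x ×-dec sep? b x ×-dec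
    adj? f y ×-dec adj? a y ×-dec sep? b y ×-dec sep? x y

  -- The cliques are N(f) ∩ N[a] and N(f) ∖ N[a].
  bisimplicial : ∀ {f a b} → Adj f a → Adj f b → Sep a b → ¬ ∃ (Single f a b) →
    ¬ (∃ λ x → ∃ λ y → Pair f a b x y) → ¬ (∃ λ x → ∃ λ y → Pair f b a x y) → Bisimplicial G f
  bisimplicial {f} {a} {b} fa fb ab no-single no-pair-a no-pair-b =
    ⟦ by-a? ⟧ , ⟦ off-a? ⟧ , K-clique , L-clique , λ u →
      mk⇔ (cover u) (λ u∈ → Sum.[ proj₁ ∘ ∈⟦⟧⁻ by-a? , proj₁ ∘ ∈⟦⟧⁻ off-a? ] (x∈p∪q⁻ _ _ u∈))
    where
    by-a? : Decidable (λ x → Adj f x × (x ≡ a ⊎ Adj a x))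
    by-a? x = adj? f x ×-dec ((x Fin.≟ a) ⊎-dec adj? a x)
    off-a? : Decidable (λ x → Adj f x × Sep a x)
    off-a? x = adj? f x ×-dec sep? a x
    cover : ∀ u → Adj f u → u ∈ ⟦ by-a? ⟧ ∪ ⟦ off-a? ⟧
    cover u fu with compare a u
    ... | same a≡u = x∈p∪q⁺ (inj₁ (∈⟦⟧⁺ by-a? (fu , inj₁ (sym a≡u))))
    ... | near au  = x∈p∪q⁺ (inj₁ (∈⟦⟧⁺ by-a? (fu , inj₂ au)))
    ... | far  au  = x∈p∪q⁺ (inj₂ (∈⟦⟧⁺ off-a? (fu , au)))
    -- If neither sees `b`, they form a forbidden pair; if both do, a-x-b-y is a `C 4`; if only one
    -- does, say x, then `f` dominates the path b-x-a-y.
    separate : ∀ {x y} → Adj f x → Adj f y → Adj a x → Adj a y → ¬ Sep x y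
    separate {x} {y} fx fy ax ay xy with compare b x | compare b y
    ... | same refl | _         = proj₂ ab ax
    ... | _         | same refl = proj₂ ab ay
    ... | far bx    | far by    = no-pair-a (x , y , fx , ax , bx , fy , ay , by , xy)
    ... | near bx   | near by   = no-C4 ax (adj-sym bx) by (adj-sym ay) ab xy
    ... | near bx   | far by    = no-gem bx (adj-sym ax) ay (Sep-sym ab) xy by fb fx fa fy
    ... | far bx    | near by   = no-gem by (adj-sym ay) ax (Sep-sym ab) (Sep-sym xy) bx fb fy fa fx
    K-clique : IsClique G ⟦ by-a? ⟧
    K-clique x∈ y∈ x≢y with ∈⟦⟧⁻ by-a? x∈ | ∈⟦⟧⁻ by-a? y∈
    ... | _  , inj₁ refl | _  , inj₁ refl = contradiction refl x≢y
    ... | _  , inj₁ refl | _  , inj₂ ay   = ay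
    ... | _  , inj₂ ax   | _  , inj₁ refl = adj-sym ax
    ... | fx , inj₂ ax   | fy , inj₂ ay   = ¬Sep⇒Adj x≢y (separate fx fy ax ay)
    L-clique : IsClique G ⟦ off-a? ⟧
    L-clique {x} {y} x∈ y∈ x≢y with ∈⟦⟧⁻ off-a? x∈ | ∈⟦⟧⁻ off-a? y∈ | compare b x | compare b y
    ... | fx , ax | _       | far bx    | _         = contradiction (x , fx , ax , bx) no-single
    ... | _       | fy , ay | _         | far by    = contradiction (y , fy , ay , by) no-single
    ... | _       | _       | same refl | same refl = contradiction refl x≢y
    ... | _       | _       | same refl | near by   = by
    ... | _       | _       | near bx   | same refl = adj-sym bx
    ... | fx , ax | fy , ay | near bx   | near by   = ¬Sep⇒Adj x≢y λ xy →
      no-pair-b (x , y , fx , bx , ax , fy , by , ay , xy)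

-- Saturated regions and the decomposition

module Main (G : Graph) (conn : Connected G)
  (¬P7 : ¬ HasInduced G (P 7)) (¬C7 : ¬ HasInduced G (C 7))
  (¬C4 : ¬ HasInduced G (C 4)) (¬gem : ¬ HasInduced G gem)
  where
  open Basics G
  open Forbidden G ¬C4 ¬gem
  open Bisimpliciality G ¬C4 ¬gem
  open Components G

  Q : Set
  Q = HasCliqueCutset G ⊎ (∃ λ v → Bisimplicial G v) ⊎ IsBlowupOf G petersen

  from-petersen : HasInduced G petersen → Q
  from-petersen h = Sum.map₂ inj₂ (Petersen.petersen⇒cutset-or-blowup G ¬C4 ¬gem ¬P7 ¬C7 conn h)

  fork-rule : ∀ r → Claw.Fork G Q r (⊥-elim ∘ ¬C4) (⊥-elim ∘ ¬gem) (⊥-elim ∘ ¬P7) (⊥-elim ∘ ¬C7)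
    from-petersen
  fork-rule _ {f} {a} {b} fa fb ab single pair-a pair-b
    with any? (λ x → adj? f x ×-dec sep? a x ×-dec sep? b x) | pair? f a b | pair? f b a
  ... | yes (x , fx , ax , bx) | _ | _ = single x fx ax bx
  ... | no _ | yes (x , y , fx , ax , bx , fy , ay , by , xy) | _ = pair-a x y fx ax bx fy ay by xy
  ... | no _ | no _ | yes (x , y , fx , bx , ax , fy , by , ay , xy) = pair-b x y fx bx ax fy by ay xy
  ... | no s | no p | no p′ = inj₂ (inj₁ (f , bisimplicial fa fb ab s p p′))

  Beyond : Subset order → Vertex → Set
  Beyond D v = ∀ x → x ∈ D → Sep v x

  Rim : Subset order → Vertex → Set
  Rim D s = s ∉ D × ∃ λ d → d ∈ D × Adj d s

  beyond? : ∀ D → Decidable (Beyond D)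
  beyond? D v = all? λ x → (x ∈? D) →-dec sep? v x

  rim? : ∀ D → Decidable (Rim D)
  rim? D s = ¬? (s ∈? D) ×-dec any? λ d → (d ∈? D) ×-dec adj? d s

  data Position (D : Subset order) (x : Vertex) : Set where
    inner  : x ∈ D → Position D x
    rim    : Rim D x → Position D x
    beyond : Beyond D x → Position D x

  position : ∀ D x → Position D x
  position D x with x ∈? D | any? (λ d → (d ∈? D) ×-dec adj? d x)
  ... | yes x∈D | _     = inner x∈D
  ... | no  x∉D | yes d = rim (x∉D , d)
  ... | no  x∉D | no ¬d = beyond λ d d∈D →
    (λ { refl → x∉D d∈D }) , λ xd → ¬d (d , d∈D , adj-sym xd)

  record Region (D : Subset order) (v : Vertex) : Set where
    field
      nonempty  : Nonempty D
      connected : ∀ {x y} → x ∈ D → y ∈ D → Path D x y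
      apart     : Beyond D v

  Saturated : Subset order → Set
  Saturated D = ∀ {m s} → Beyond D m → Rim D s → Adj m s

  -- If `m` beyond `D` misses the rim vertex `s`, then `s` can join `D`; `m` stays beyond the larger
  -- set and replaces `v` as its witness.
  saturate : ∀ {D v} → Region D v → Acc _⊃_ D → ∃ λ D → ∃ λ v → Region D v × Saturated D
  saturate {D} {v} R (acc rs)
    with any? (λ m → any? (λ s → beyond? D m ×-dec rim? D s ×-dec sep? m s))
  ... | yes (m , s , mD , (s∉D , d , d∈D , ds) , ms) =
    saturate enlarged (rs (p⊆p∪q ⁅ s ⁆ , s , x∈p∪q⁺ (inj₂ (x∈⁅x⁆ s)) , s∉D))
    where
    E = D ∪ ⁅ s ⁆
    lift : ∀ {x y} → Path D x y → Path E x y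
    lift = Star.map λ (x∈ , y∈ , xy) → p⊆p∪q ⁅ s ⁆ x∈ , p⊆p∪q ⁅ s ⁆ y∈ , xy
    s∈E : s ∈ E
    s∈E = x∈p∪q⁺ (inj₂ (x∈⁅x⁆ s))
    from-d : ∀ {y} → y ∈ D ⊎ y ∈ ⁅ s ⁆ → Path E d y
    from-d (inj₁ y∈D) = lift (Region.connected R d∈D y∈D)
    from-d (inj₂ y∈s) = subst (Path E d) (sym (x∈⁅y⁆⇒x≡y s y∈s)) ((p⊆p∪q ⁅ s ⁆ d∈D , s∈E , ds) ◅ ε)
    away : ∀ {x} → x ∈ D ⊎ x ∈ ⁅ s ⁆ → Sep m x
    away (inj₁ x∈D) = mD _ x∈D
    away (inj₂ x∈s) = subst (Sep m) (sym (x∈⁅y⁆⇒x≡y s x∈s)) ms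
    enlarged : Region E m
    enlarged = record
      { nonempty  = s , s∈E
      ; connected = λ x∈ y∈ → Path-sym (from-d (x∈p∪q⁻ D ⁅ s ⁆ x∈)) ◅◅ from-d (x∈p∪q⁻ D ⁅ s ⁆ y∈)
      ; apart     = λ x x∈ → away (x∈p∪q⁻ D ⁅ s ⁆ x∈)
      }
  ... | no  none = D , v , R , λ {m} {s} mD sD@(_ , d , d∈D , ds) →
    ¬Sep⇒Adj (λ { refl → proj₂ (mD d d∈D) (adj-sym ds) }) λ ms → none (m , s , mD , sD , ms)

  singleton-region : ∀ {u v} → Sep v u → Region ⁅ u ⁆ v
  singleton-region {u} {v} vu = record
    { nonempty  = u , x∈⁅x⁆ u
    ; connected = λ {x} {y} x∈ y∈ →
        subst (λ x → Path ⁅ u ⁆ x y) (sym (x∈⁅y⁆⇒x≡y u x∈))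
              (subst (Path ⁅ u ⁆ u) (sym (x∈⁅y⁆⇒x≡y u y∈)) ε)
    ; apart     = λ x x∈ → subst (Sep v) (sym (x∈⁅y⁆⇒x≡y u x∈)) vu
    }

  rim-cutset : ∀ {D v} → Region D v →
    ¬ (∃ λ s → ∃ λ t → Rim D s × Rim D t × Sep s t) → HasCliqueCutset G
  rim-cutset {D} {v} R none = clique-cutset conn clique (proj₂ nonempty)
    (λ u∈K → proj₁ (∈⟦⟧⁻ (rim? D) u∈K) (proj₂ nonempty))
    (λ v∈D → proj₁ (apart v v∈D) refl)
    (λ v∈K → let _ , d , d∈D , dv = ∈⟦⟧⁻ (rim? D) v∈K in proj₂ (apart d d∈D) (adj-sym dv))
    closed
    where
    open Region R
    clique : IsClique G ⟦ rim? D ⟧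
    clique {s} {t} s∈ t∈ s≢t = ¬Sep⇒Adj s≢t λ st →
      none (s , t , ∈⟦⟧⁻ (rim? D) s∈ , ∈⟦⟧⁻ (rim? D) t∈ , st)
    closed : Closed (∁ ⟦ rim? D ⟧) D
    closed {d} {z} d∈D z∈ dz with z ∈? D
    ... | yes z∈D = z∈D
    ... | no  z∉D = contradiction (∈⟦⟧⁺ (rim? D) (z∉D , d , d∈D , dz)) (x∈∁p⇒x∉p z∈)

  Good : Vertex → Vertex → Set
  Good r a = ∀ {x y} → Adj r x → Adj r y → Adj a x → Adj a y → ¬ Sep x y

  -- If `a` is not good, it is replaced by one of two independent common neighbours `u`, `w` of `r`
  -- and `a`. The non-neighbours of `u` in N(r) include those of `a` and also `w`, so the process
  -- stops.
  refine : ∀ {r a} → Adj r a →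
    ∃ λ b → Adj r b × Good r b × (∀ {x} → Adj r x → Sep a x → Sep b x)
  refine {r} {a} ra = go a ra (⊃-wellFounded _)
    where
    outer? : ∀ a → Decidable (λ x → Adj r x × Sep a x)
    outer? a x = adj? r x ×-dec sep? a x
    go : ∀ a → Adj r a → Acc _⊃_ ⟦ outer? a ⟧ →
      ∃ λ b → Adj r b × Good r b × (∀ {x} → Adj r x → Sep a x → Sep b x)
    go a ra (acc rs) with any? (λ u → any? (λ w →
      adj? r u ×-dec adj? r w ×-dec adj? a u ×-dec adj? a w ×-dec sep? u w))
    ... | no good = a , ra , (λ {x} {y} rx ry ax ay xy → good (x , y , rx , ry , ax , ay , xy)) , λ _ ax → ax
    ... | yes (u , w , ru , rw , au , aw , uw) =
      let b , rb , good , further = go u ru (rs (larger , w , ∈⟦⟧⁺ (outer? u) (rw , uw) ,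
            λ w∈ → proj₂ (proj₂ (∈⟦⟧⁻ (outer? a) w∈)) aw))
      in b , rb , (λ {x} {y} → good {x} {y}) , λ rx ax → further rx (shrinks rx ax)
      where
      -- If `u` saw `x`, then a-u-x-w would be a `C 4` when `w` sees `x` too, and otherwise `r`
      -- would dominate the path x-u-a-w.
      shrinks : ∀ {x} → Adj r x → Sep a x → Sep u x
      shrinks {x} rx ax with compare u x | compare w x
      ... | same refl | _         = contradiction au (proj₂ ax)
      ... | far ux    | _         = ux
      ... | near ux   | same refl = contradiction aw (proj₂ ax)
      ... | near ux   | near wx   = contradiction uw (no-C4 au ux (adj-sym wx) (adj-sym aw) ax)
      ... | near ux   | far wx    = contradiction rw
        (no-gem (adj-sym ux) (adj-sym au) aw (Sep-sym ax) uw (Sep-sym wx) rx ru ra)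
      larger : ∀ {x} → x ∈ ⟦ outer? a ⟧ → x ∈ ⟦ outer? u ⟧
      larger x∈ = let rx , ax = ∈⟦⟧⁻ (outer? a) x∈ in ∈⟦⟧⁺ (outer? u) (rx , shrinks rx ax)

  module Saturation {D r} (R : Region D r) (sat : Saturated D)
    {s t} (sD : Rim D s) (tD : Rim D t) (st : Sep s t) where
    open Region R
    open Walks G r

    rs : Adj r s
    rs = sat apart sD

    rt : Adj r t
    rt = sat apart tD

    -- By saturation both see the independent `s` and `t`, which would complete a `C 4`.
    beyonds-linked : ∀ {m n} → Beyond D m → Beyond D n → ¬ Sep m n
    beyonds-linked mD nD = no-C4 (adj-sym (sat mD sD)) (sat mD tD) (adj-sym (sat nD tD)) (sat nD sD) st

    away⇒inner : ∀ {x} → Away x → x ∈ D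
    away⇒inner {x} rx with position D x
    ... | inner x∈D = x∈D
    ... | rim xD    = contradiction (sat apart xD) (proj₂ rx)
    ... | beyond xD = contradiction rx (beyonds-linked apart xD)

    linked : ∀ {x y} → Away x → Away y → Star AwayStep x y
    linked rx ry = Star.map (λ (_ , y∈D , xy) → xy , apart _ y∈D)
      (connected (away⇒inner rx) (away⇒inner ry))

    joined : ∀ {x y} → Adj r x → Adj r y → Sep x y → Joined x
    joined {x} {y} rx ry xy with position D x | position D y
    ... | inner x∈D             | _         = contradiction rx (proj₂ (apart x x∈D))
    ... | _                     | inner y∈D = contradiction ry (proj₂ (apart y y∈D))
    ... | rim (_ , d , d∈D , dx) | _         = d , apart d d∈D , adj-sym dx
    ... | beyond xD             | rim yD    = contradiction (sat xD yD) (proj₂ xy)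
    ... | beyond xD             | beyond yD = contradiction xy (beyonds-linked xD yD)

    -- Lets walks begin or end at vertices of `D`. By connectedness it fails only if `x` is the sole
    -- vertex of `D`; then r-s-x-t would be a `C 4`.
    spread : ∀ {x} → Away x → Joined x
    spread {x} rx with joined rs rt st | joined rt rs (Sep-sym st)
    ... | d , rd , sd | e , re , te = other (d Fin.≟ x)
      where
      step-off : ∀ {z} → z ≢ x → Away z → Joined x
      step-off z≢x rz with linked rx rz
      ... | ε                   = contradiction refl z≢x
      ... | (xy , ry) ◅ _       = _ , ry , xy
      other : Dec (d ≡ x) → Joined x
      other (no  d≢x)  = step-off d≢x rd
      other (yes refl) = step-off {e} (λ { refl → no-C4 rs sd (adj-sym te) (adj-sym rt) rd st }) re

    open Claw G Q r (⊥-elim ∘ ¬C4) (⊥-elim ∘ ¬gem) (⊥-elim ∘ ¬P7) (⊥-elim ∘ ¬C7)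
      from-petersen using (claw-settles)

    settled-triple : ∀ {a b c} → Adj r a → Adj r b → Adj r c → Sep a b → Sep a c → Sep b c → Q
    settled-triple ra rb rc ab ac bc with refine ra
    ... | a′ , ra′ , good-a , near-a with refine rb
    ...   | b′ , rb′ , good-b , near-b with refine rc
    ...     | c′ , rc′ , good-c , near-c = claw-settles (fork-rule r) linked spread
      (λ { 0 → r ; 1 → a′ ; 2 → b′ ; _ → c′ })
      (refl ∷ (joined ra′ rb′ ab′ , good-a) ∷ (joined rb′ ra′ (Sep-sym ab′) , good-b)
            ∷ (joined rc′ ra′ (Sep-sym ac′) , good-c)
            ∷ ra′ ∷ rb′ ∷ rc′ ∷ ab′ ∷ ac′ ∷ bc′ ∷ [])
      where
      -- Refinement preserves non-neighbours in N(r): first `a` is replaced while `b` stays, then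
      -- `b` while `a′` stays.
      ab′ : Sep a′ b′
      ab′ = Sep-sym (near-b ra′ (Sep-sym (near-a rb ab)))
      ac′ : Sep a′ c′
      ac′ = Sep-sym (near-c ra′ (Sep-sym (near-a rc ac)))
      bc′ : Sep b′ c′
      bc′ = Sep-sym (near-c rb′ (Sep-sym (near-b rc bc)))

    -- A fork at `r` itself: in each outcome three independent neighbours appear, either `s`, `t`
    -- and a new vertex, or one of `s`, `t` with a new pair.
    settled : Q
    settled = fork-rule r rs rt st
      (λ x rx sx tx → settled-triple rs rt rx st sx tx)
      (λ x y rx _ tx ry _ ty xy → settled-triple rt rx ry tx ty xy)
      (λ x y rx _ sx ry _ sy xy → settled-triple rs rx ry sx sy xy)

  decomposition : Q
  decomposition with any? (λ v → any? (λ u → sep? v u))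
  ... | no complete = trivial (any? {P = λ (_ : Vertex) → ⊤} (λ _ → yes tt))
    where
    trivial : Dec (∃ λ (_ : Vertex) → ⊤) → Q
    trivial (yes (v , _)) = inj₂ (inj₁ (v , simplicial λ _ _ x≢y →
      ¬Sep⇒Adj x≢y λ xy → complete (_ , _ , xy)))
    -- The graph without vertices is the blowup in which all ten cliques are empty.
    trivial (no  empty)   = inj₂ (inj₂ ((λ _ → Subset.⊥) , (λ v → contradiction (v , tt) empty) ,
      (λ _ {u} → contradiction (u , tt) empty) , (λ _ {u} → contradiction (u , tt) empty) ,
      (λ _ _ {u} → contradiction (u , tt) empty)))
  ... | yes (v , u , vu) with saturate (singleton-region vu) (⊃-wellFounded _)
  ...   | D , r , R , sat with any? (λ s → any? (λ t → rim? D s ×-dec rim? D t ×-dec sep? s t))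
  ...     | yes (s , t , sD , tD , st) = Saturation.settled R (λ {m} {s} → sat {m} {s}) sD tD st
  ...     | no  none                   = inj₁ (rim-cutset R none)

theorem4p5 : (G : Graph) → Connected G → Free (P 7 ∷ C 7 ∷ C 4 ∷ gem ∷ []) G →
    HasCliqueCutset G ⊎ (∃ λ v → Bisimplicial G v) ⊎ IsBlowupOf G petersen
theorem4p5 G conn (¬P7 ∷ ¬C7 ∷ ¬C4 ∷ ¬gem ∷ []) = Main.decomposition G conn ¬P7 ¬C7 ¬C4 ¬gem
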